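{- Let $\ell$ and $k$ be integers with $2 \le \ell < k$, and let $H$ be an $\ell$-covering $k$-hypergraph. Then $H$ admits an Euler family if and only if $H$ has at least two edges.
   Context: A hypergraph $H$ is a pair $(V,E)$ where $V$ is a non-empty finite set (the vertices) and $E$ is a finite multiset of subsets of $V$ (the edges); repeated (parallel) edges are allowed and count as distinct edges. $H$ is empty if it has no edges, and is $k$-uniform if every edge has cardinality $k$. For integers $2\le \ell<k$, an $\ell$-covering $k$-hypergraph is a non-empty (i.e. having at least one edge) $k$-uniform hypergraph in which every $\ell$-subset of vertices is contained in at least one edge. A $(v_0,v_s)$-walk in $H$ is a sequence $W=v_0e_1v_1e_2\ldots e_sv_s$ with $v_0,\ldots,v_s\in V$, $e_1,\ldots,e_s\in E$, and $v_{i-1},v_i\in e_i$ with $v_{i-1}\ne v_i$ for all $i=1,\ldots,s$. It traverses each of the vertices and edges in the sequence; the vertices $v_0,\ldots,v_s$ are its anchors. $W$ is a trail if $e_1,\ldots,e_s$ are pairwise distinct (as members of the multiset $E$), and it is closed if $v_0=v_s$ and $s\ge 2$. An Euler family of $H$ is a collection of pairwise anchor-disjoint and pairwise edge-disjoint closed trails that jointly traverse every edge of $H$. -}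

module Defs where

open import Data.Fin using (Fin)
open import Data.Fin.Subset using (Subset; _∈_; _⊆_; ∣_∣)
open import Data.List using (List; []; _∷_; length)
import Data.List.Membership.Propositional as List
open import Data.List.Relation.Binary.Disjoint.Propositional using (Disjoint)
open import Data.List.Relation.Unary.AllPairs using (AllPairs)
open import Data.List.Relation.Unary.Any using (Any)
open import Data.List.Relation.Unary.Unique.Propositional using (Unique)
open import Data.Nat using (ℕ; _≤_; _<_; NonZero)
open import Data.Product using (∃)
open import Relation.Binary.PropositionalEquality using (_≡_; _≢_)

-- The multiset of edges is an indexed family of vertex subsets: an edge is an
-- index, so parallel edges are distinct indices carrying the same subset.
record Hypergraph : Set where
  field
    order         : ℕ
    .{{nonempty}} : NonZero order
    size          : ℕ

  V : Set
  V = Fin order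

  E : Set
  E = Fin size

  field
    edge : E → Subset order

open Hypergraph public using (order; size; V; E; edge)

Uniform : ℕ → Hypergraph → Set
Uniform k H = (e : E H) → ∣ edge H e ∣ ≡ k

record Covering (ℓ k : ℕ) (H : Hypergraph) : Set where
  field
    hasEdge : 0 < size H
    uniform : Uniform k H
    covers  : (S : Subset (order H)) → ∣ S ∣ ≡ ℓ → ∃ λ e → S ⊆ edge H e

module _ (H : Hypergraph) where

  data Walk : V H → V H → Set where
    stop : (v : V H) → Walk v v
    step : (u : V H) (e : E H) {v w : V H} →
           u ∈ edge H e → v ∈ edge H e → u ≢ v →
           Walk v w → Walk u w

module _ {H : Hypergraph} where

  anchors : {u v : V H} → Walk H u v → List (V H)
  anchors (stop v)           = v ∷ []
  anchors (step u _ _ _ _ W) = u ∷ anchors W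

  edges : {u v : V H} → Walk H u v → List (E H)
  edges (stop _)           = []
  edges (step _ e _ _ _ W) = e ∷ edges W

  IsTrail : {u v : V H} → Walk H u v → Set
  IsTrail W = Unique (edges W)

record ClosedTrail (H : Hypergraph) : Set where
  field
    {base}  : V H
    walk    : Walk H base base
    isTrail : IsTrail walk
    2≤steps : 2 ≤ length (edges walk)

open ClosedTrail public using (walk)

-- A list may represent the collection: a closed trail traverses some edge, so
-- edge-disjointness across positions already excludes repeated members and
-- makes every such collection finite.
record IsEulerFamily {H : Hypergraph} (F : List (ClosedTrail H)) : Set where
  field
    anchorDisjoint : AllPairs (λ S T → Disjoint (anchors (walk S)) (anchors (walk T))) F
    edgeDisjoint   : AllPairs (λ S T → Disjoint (edges (walk S)) (edges (walk T))) F
    traversesAll   : (e : E H) → Any (λ T → e List.∈ edges (walk T)) F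

AdmitsEulerFamily : Hypergraph → Set
AdmitsEulerFamily H = ∃ λ (F : List (ClosedTrail H)) → IsEulerFamily F

{-# OPTIONS --safe #-}
module Submission where

-- An Euler family amounts to a choice of two vertices in every edge such that
-- the resulting multigraph has even degrees: its components then have Euler
-- circuits. Since ℓ ≥ 2 every two vertices share an edge, and k ≥ 3.
--
-- Take an even choice on as many edges as possible and suppose that the edge e
-- is left out. Grow a set of vertices, divided into classes, such that for all
-- x and y in different classes the choice can be changed on explored edges, so
-- that it covers e as well and has odd degree exactly at x and y. If an
-- unexplored edge h contains such x and y, and the pair chosen in h separates
-- x from another vertex o of h, then exchanging x and o in that pair moves the
-- odd degree from x to o. By maximality h does not separate x from y, and all
-- the vertices of h on the other side are new and form new classes. Pairs of
-- vertices in different classes appear faster than explored edges can contain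
-- them, so the growth never stops, which is absurd.

open import Defs
open import Data.Nat using (ℕ; _≤_; _<_)
open import Function.Bundles using (_⇔_)
open import Data.Bool using (Bool; true; false; _xor_; if_then_else_)
import Data.Bool.Properties as Bool
open import Data.Bool.Properties using (xor-comm; xor-same)
open import Data.Bool.Solver using (module xor-∧-Solver)
open import Data.Empty using (⊥; ⊥-elim)
open import Data.Fin using (Fin; zero; suc; fromℕ<; _≟_)
open import Data.Fin.Properties using (any?; all?; suc-injective)
open import Data.Fin.Subset using (Subset; inside; outside; _∈_; _⊆_; _∪_; ⁅_⁆; ∣_∣) renaming (⊤ to Subset⊤)
open import Data.Fin.Subset.Properties using (_∈?_; s⊆s; ⊆⊤; ∣⊤∣≡n; ∣p∣≤n; p⊆p∪q; q⊆p∪q; x∈⁅x⁆; x∈⁅y⁆⇒x≡y; x∈p∪q⁻)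
open import Data.List using (List; []; _∷_; _++_; length; concatMap; foldr; tabulate; allFin)
import Data.List.Membership.Propositional as List
open import Data.List.Membership.Propositional.Properties using (∈-∃++; ∈-++⁻; ∈-++⁺ˡ; ∈-++⁺ʳ; ∈-allFin)
open import Data.List.Properties using (++-assoc; length-++)
open import Data.List.Relation.Binary.Disjoint.Propositional using (Disjoint)
import Data.List.Relation.Binary.Permutation.Propositional as Perm
open Perm using (_↭_; ↭-refl; ↭-sym; ↭-trans; ↭-reflexive; ↭⇒↭ₛ)
open import Data.List.Relation.Binary.Permutation.Propositional.Properties using (↭-length; shift; shifts; ++⁺; ++⁺ˡ; ++⁺ʳ; ∈-resp-↭) renaming (++-comm to ↭-++-comm)
import Data.List.Relation.Binary.Permutation.Setoid.Properties as PermSetoid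
open import Data.List.Relation.Unary.All as All using (All; []; _∷_)
open import Data.List.Relation.Unary.AllPairs using (AllPairs; []; _∷_)
open import Data.List.Relation.Unary.Any as Any using (Any; here; there)
open import Data.List.Relation.Unary.Unique.Propositional using (Unique)
open import Data.List.Relation.Unary.Unique.Propositional.Properties using (allFin⁺)
open import Data.Nat using (zero; suc; _+_; _*_; _∸_; z≤n; s≤s)
open import Data.Nat.Properties hiding (_≟_; suc-injective)
open import Data.Nat.Tactic.RingSolver using (solve-∀)
open import Data.Product using (Σ; ∃; ∃₂; _×_; _,_; proj₁; proj₂)
open import Data.Sum using (_⊎_; inj₁; inj₂; [_,_]′)
open import Data.Unit using (⊤; tt)
open import Data.Vec using ([]; _∷_)
open import Function using (_∘_; id; case_of_)
open import Function.Bundles using (mk⇔)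
open import Relation.Binary.PropositionalEquality
open import Relation.Nullary using (Dec; yes; no; ¬_; does; contradiction; ¬?; _×-dec_; _⊎-dec_)
open import Relation.Nullary.Decidable using (map′; decidable-stable)
open import Relation.Unary using (Decidable)
open import Algebra.Properties.Semiring.Sum +-*-semiring
  using (sum; sum-cong-≗; ∑-distrib-+; ∑-comm; *-distribˡ-sum; *-distribʳ-sum)

-- For a grown set let ω be its number of vertices, P the number of ordered pairs of vertices in
-- different classes, and C a bound for those lying in explored edges. The count rests on P - C +
-- 2(ω - k): a growth step brings P - C itself up to at least this value. Once positive, the value
-- stays positive because ω ≥ k, and P > C yields an unexplored edge across two classes.
--
-- Two obstacles shape the rest. An edge whose pair avoids x and y brings in only two vertices but
-- may cost k(k - 1), so it has to be combined with a second edge at one of them, whose own pair may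
-- lead out of the set. And the start, the vertices of e as k singleton classes, has value exactly
-- 0. The missing strictness comes from the edges around e: each of them meets e in at most one
-- vertex, and no pair chosen in them has an end in e. An exchange in two edges that keeps the
-- choice maximal finally contradicts this.

private variable
  n m : ℕ

-- Counting and parity

sum-mono-≤ : {f g : Fin n → ℕ} → (∀ i → f i ≤ g i) → sum f ≤ sum g
sum-mono-≤ {zero}  f≤g = z≤n
sum-mono-≤ {suc n} f≤g = +-mono-≤ (f≤g zero) (sum-mono-≤ (f≤g ∘ suc))

sum-mono-< : {f g : Fin n → ℕ} → (∀ i → f i ≤ g i) → ∀ i → f i < g i → sum f < sum g
sum-mono-< f≤g zero    f<g = +-mono-<-≤ f<g (sum-mono-≤ (f≤g ∘ suc))
sum-mono-< f≤g (suc i) f<g = +-mono-≤-< (f≤g zero) (sum-mono-< (f≤g ∘ suc) i f<g)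

≤-sum : (f : Fin n → ℕ) → ∀ i → f i ≤ sum f
≤-sum f zero    = m≤m+n _ _
≤-sum f (suc i) = ≤-trans (≤-sum (f ∘ suc) i) (m≤n+m _ _)

sum-zeros : ∀ n → sum {n} (λ _ → 0) ≡ 0
sum-zeros zero    = refl
sum-zeros (suc n) = sum-zeros n

sum-ones : ∀ n → sum {n} (λ _ → 1) ≡ n
sum-ones zero    = refl
sum-ones (suc n) = cong suc (sum-ones n)

sum-* : (f : Fin m → ℕ) (g : Fin n → ℕ) →
        sum (λ i → sum (λ j → f i * g j)) ≡ sum f * sum g
sum-* f g = trans (sum-cong-≗ λ i → sym (*-distribˡ-sum (f i) g)) (sym (*-distribʳ-sum (sum g) f))

∑∑-distrib-+ : (f g : Fin m → Fin n → ℕ) →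
               sum (λ i → sum (λ j → f i j + g i j)) ≡
               sum (λ i → sum (f i)) + sum (λ i → sum (g i))
∑∑-distrib-+ f g = trans (sum-cong-≗ λ i → ∑-distrib-+ (f i) (g i)) (∑-distrib-+ (sum ∘ f) (sum ∘ g))

𝟙 : {P : Set} → Dec P → ℕ
𝟙 P? = if does P? then 1 else 0

count : {P : Fin n → Set} → Decidable P → ℕ
count P? = sum λ i → 𝟙 (P? i)

private variable
  P Q R : Set

𝟙≤1 : (P? : Dec P) → 𝟙 P? ≤ 1
𝟙≤1 (yes _) = ≤-refl
𝟙≤1 (no _)  = z≤n

𝟙-yes : (P? : Dec P) → P → 𝟙 P? ≡ 1
𝟙-yes (yes _) _ = refl
𝟙-yes (no ¬p) p = contradiction p ¬p

𝟙-no : (P? : Dec P) → ¬ P → 𝟙 P? ≡ 0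
𝟙-no (yes p) ¬p = contradiction p ¬p
𝟙-no (no _)  _  = refl

𝟙-≤ : (P? : Dec P) {c : ℕ} → (P → 1 ≤ c) → 𝟙 P? ≤ c
𝟙-≤ (yes p) f = f p
𝟙-≤ (no _)  f = z≤n

𝟙-mono : (P? : Dec P) (Q? : Dec Q) → (P → Q) → 𝟙 P? ≤ 𝟙 Q?
𝟙-mono (yes p) Q? f = ≤-reflexive (sym (𝟙-yes Q? (f p)))
𝟙-mono (no _)  Q? f = z≤n

𝟙-cong : (P? : Dec P) (Q? : Dec Q) → (P → Q) → (Q → P) → 𝟙 P? ≡ 𝟙 Q?
𝟙-cong P? Q? f g = ≤-antisym (𝟙-mono P? Q? f) (𝟙-mono Q? P? g)

𝟙-× : (P? : Dec P) (Q? : Dec Q) → 𝟙 (P? ×-dec Q?) ≡ 𝟙 P? * 𝟙 Q?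
𝟙-× (yes _) (yes _) = refl
𝟙-× (yes _) (no _)  = refl
𝟙-× (no _)  _       = refl

𝟙-union : (P? : Dec P) (Q? : Dec Q) (R? : Dec R) → (R → P ⊎ Q) → 𝟙 R? ≤ 𝟙 P? + 𝟙 Q?
𝟙-union P? Q? (no _)  f = z≤n
𝟙-union P? Q? (yes r) f with f r
... | inj₁ p = ≤-trans (≤-reflexive (sym (𝟙-yes P? p))) (m≤m+n _ _)
... | inj₂ q = ≤-trans (≤-reflexive (sym (𝟙-yes Q? q))) (m≤n+m _ _)

𝟙-disjoint : (P? : Dec P) (Q? : Dec Q) (R? : Dec R) → (P → R) → (Q → R) → (P → Q → ⊥) →
             𝟙 P? + 𝟙 Q? ≤ 𝟙 R?
𝟙-disjoint (no _)  Q?      R? f g _ = 𝟙-mono Q? R? g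
𝟙-disjoint (yes p) (yes q) R? f g d = ⊥-elim (d p q)
𝟙-disjoint (yes p) (no _)  R? f g _ = ≤-reflexive (sym (𝟙-yes R? (f p)))

count-≟ : (x : Fin n) → count (x ≟_) ≡ 1
count-≟ {suc n} zero = cong suc (sum-zeros n)
count-≟ {suc n} (suc x) = trans (sum-cong-≗ λ i → 𝟙-cong (suc x ≟ suc i) (x ≟ i) suc-injective (cong suc)) (count-≟ x)

count≤n : {P : Fin n → Set} (P? : Decidable P) → count P? ≤ n
count≤n {n} P? = ≤-trans (sum-mono-≤ (𝟙≤1 ∘ P?)) (≤-reflexive (sum-ones n))

count-pos : {P : Fin n → Set} (P? : Decidable P) → 1 ≤ count P? → ∃ P
count-pos {n} P? 1≤ with any? P?
... | yes ex = ex
... | no ¬ex = contradiction (≤-trans 1≤ (≤-reflexive none)) λ ()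
  where
  none : count P? ≡ 0
  none = trans (sum-cong-≗ λ i → 𝟙-no (P? i) (¬ex ∘ (i ,_))) (sum-zeros n)

⨁ : (Fin n → Bool) → Bool
⨁ {zero}  f = false
⨁ {suc n} f = f zero xor ⨁ (f ∘ suc)

⨁-cong : {f g : Fin n → Bool} → (∀ i → f i ≡ g i) → ⨁ f ≡ ⨁ g
⨁-cong {zero}  f≗g = refl
⨁-cong {suc n} f≗g = cong₂ _xor_ (f≗g zero) (⨁-cong (f≗g ∘ suc))

⨁-zeros : ∀ n → ⨁ {n} (λ _ → false) ≡ false
⨁-zeros zero    = refl
⨁-zeros (suc n) = ⨁-zeros n

⨁-update : (f g : Fin n → Bool) (i : Fin n) → (∀ j → j ≢ i → g j ≡ f j) →
           ⨁ g ≡ ⨁ f xor (f i xor g i)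
⨁-update f g zero g≗f
  rewrite ⨁-cong {f = g ∘ suc} {g = f ∘ suc} (λ j → g≗f (suc j) λ ()) =
  solve 3 (λ a b s → b :+ s := (a :+ s) :+ (a :+ b)) refl (f zero) (g zero) (⨁ (f ∘ suc))
  where open xor-∧-Solver
⨁-update f g (suc i) g≗f
  rewrite ⨁-update (f ∘ suc) (g ∘ suc) i (λ j j≢i → g≗f (suc j) (j≢i ∘ suc-injective))
        | g≗f zero (λ ()) =
  solve 3 (λ a b s → a :+ (s :+ b) := (a :+ s) :+ b) refl (f zero) (f (suc i) xor g (suc i)) (⨁ (f ∘ suc))
  where open xor-∧-Solver

⨁-true : (f : Fin n → Bool) → ⨁ f ≡ true → ∃ λ i → f i ≡ true
⨁-true {suc n} f eq with f zero in fz
... | true  = zero , fz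
... | false with ⨁-true (f ∘ suc) eq
...   | i , fi = suc i , fi

δ : Fin n → Fin n → Bool
δ x v = does (x ≟ v)

δ-refl : (x : Fin n) → δ x x ≡ true
δ-refl x with x ≟ x
... | yes _  = refl
... | no x≢x = contradiction refl x≢x

δ-≢ : {x y : Fin n} → x ≢ y → δ x y ≡ false
δ-≢ {x = x} {y} x≢y with x ≟ y
... | yes x≡y = contradiction x≡y x≢y
... | no _    = refl

Proper : Fin n × Fin n → Set
Proper (a , b) = a ≢ b

Proper? : Decidable (Proper {n})
Proper? (a , b) = ¬? (a ≟ b)

End : Fin n × Fin n → Fin n → Set
End (a , b) c = c ≡ a ⊎ c ≡ b

End? : (ab : Fin n × Fin n) → Decidable (End ab)
End? (a , b) c = c ≟ a ⊎-dec c ≟ b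

ends : Fin n × Fin n → Fin n → Bool
ends (a , b) v = δ a v xor δ b v

ends-true : (ab : Fin n × Fin n) {v : Fin n} → ends ab v ≡ true → Proper ab × End ab v
ends-true (a , b) {v} eq with a ≟ v | b ≟ v
... | yes refl | no b≢v   = (λ a≡b → b≢v (sym a≡b)) , inj₁ refl
... | no a≢v   | yes refl = a≢v , inj₂ refl

ends-improper : (ab : Fin n × Fin n) → ¬ Proper ab → ∀ v → ends ab v ≡ false
ends-improper ab ¬proper v with ends ab v in eq
... | true  = contradiction (proj₁ (ends-true ab eq)) ¬proper
... | false = refl

ends-proper : (ab : Fin n × Fin n) {v : Fin n} → Proper ab → End ab v → ends ab v ≡ true
ends-proper (a , b) a≢b (inj₁ refl) rewrite δ-refl a | δ-≢ (a≢b ∘ sym) = refl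
ends-proper (a , b) a≢b (inj₂ refl) rewrite δ-refl b | δ-≢ a≢b = refl

-- Exhaustive search over functions on a finite set

Search : Set → Set₁
Search A = {P : A → Set} → Decidable P → Dec (∃ P)

search-× : {A B : Set} → Search A → Search B → Search (A × B)
search-× searchA searchB P? = map′ (λ (a , b , p) → (a , b) , p) (λ ((a , b) , p) → a , b , p)
  (searchA λ a → searchB λ b → P? (a , b))

-- Without extensionality a function is only pointwise equal to the one assembled by `cons`, so the
-- predicate has to respect pointwise equality.
search-→ : {A : Set} → Search A → {P : (Fin m → A) → Set} →
           (∀ {f g} → (∀ i → f i ≡ g i) → P f → P g) → Decidable P → Dec (∃ P)
search-→ {zero} searchA P-resp P? = map′ (_ ,_) (λ (f , pf) → P-resp (λ ()) pf) (P? λ ())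
search-→ {suc m} searchA {P} P-resp P? = map′
  (λ (a , f , p) → cons a f , p)
  (λ (f , p) → f zero , f ∘ suc , P-resp (λ { zero → refl ; (suc i) → refl }) p)
  (searchA λ a → search-→ searchA (λ eq → P-resp λ { zero → refl ; (suc i) → eq i }) (λ f → P? (cons a f)))
  where
  cons : {A : Set} → A → (Fin m → A) → Fin (suc m) → A
  cons a f zero    = a
  cons a f (suc i) = f i

-- Even choices

module PairCover {n m : ℕ} (j : ℕ)
  (Mem : Fin m → Fin n → Set) (Mem? : ∀ f → Decidable (Mem f))
  (card : ∀ f → count (Mem? f) ≡ 3 + j)
  (cover : ∀ {x y} → x ≢ y → ∃ λ f → Mem f x × Mem f y) where

  private
    Vertex = Fin n
    Edge = Fin m
    k = 3 + j

  -- A pair (a , a) encodes an edge that is not used.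
  Choice : Set
  Choice = Edge → Vertex × Vertex

  Admissible : Choice → Set
  Admissible p = ∀ f → Mem f (proj₁ (p f)) × Mem f (proj₂ (p f))

  parity : Choice → Vertex → Bool
  parity p v = ⨁ λ f → ends (p f) v

  Even : Choice → Set
  Even p = ∀ v → parity p v ≡ false

  used : Choice → ℕ
  used p = count (Proper? ∘ p)

  set : Choice → Edge → Vertex × Vertex → Choice
  set p h ab f = if does (f ≟ h) then ab else p f

  set-here : ∀ p h ab → set p h ab h ≡ ab
  set-here p h ab with h ≟ h
  ... | yes _  = refl
  ... | no h≢h = contradiction refl h≢h

  set-there : ∀ p h ab {f} → f ≢ h → set p h ab f ≡ p f
  set-there p h ab {f} f≢h with f ≟ h
  ... | yes f≡h = contradiction f≡h f≢h
  ... | no _    = refl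

  parity-set : ∀ p h ab v → parity (set p h ab) v ≡ parity p v xor (ends (p h) v xor ends ab v)
  parity-set p h ab v =
    trans (⨁-update (λ f → ends (p f) v) (λ f → ends (set p h ab f) v) h
             (λ f f≢h → cong (λ cd → ends cd v) (set-there p h ab f≢h)))
          (cong (λ cd → parity p v xor (ends (p h) v xor ends cd v)) (set-here p h ab))

  admissible-set : ∀ {p h a b} → Admissible p → Mem h a → Mem h b → Admissible (set p h (a , b))
  admissible-set {h = h} adm ha hb f with f ≟ h
  ... | yes refl = ha , hb
  ... | no _     = adm f

  used-set : ∀ p h {ab} → Proper ab → used p ≤ used (set p h ab)
  used-set p h {ab} a≢b = sum-mono-≤ λ f → 𝟙-mono (Proper? (p f)) (Proper? (set p h ab f)) (keep f)
    where
    keep : ∀ f → Proper (p f) → Proper (set p h ab f)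
    keep f pf with f ≟ h
    ... | yes _ = a≢b
    ... | no _  = pf

  used-set-< : ∀ p h {ab} → ¬ Proper (p h) → Proper ab → used p < used (set p h ab)
  used-set-< p h {ab} ph a≢b = sum-mono-< (λ f → 𝟙-mono (Proper? (p f)) (Proper? (set p h ab f)) (keep f)) h strict
    where
    keep : ∀ f → Proper (p f) → Proper (set p h ab f)
    keep f pf with f ≟ h
    ... | yes _ = a≢b
    ... | no _  = pf

    strict : 𝟙 (Proper? (p h)) < 𝟙 (Proper? (set p h ab h))
    strict rewrite set-here p h ab | 𝟙-no (Proper? (p h)) ph | 𝟙-yes (Proper? ab) a≢b = s≤s z≤n

  -- Giving `h` the improper pair `(c , c)` makes the even parity at `c` odd. Some edge therefore
  -- still contributes at `c`, and it is not `h`, whose pair is now improper.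
  other-edge : ∀ p h {c} → Even p → Proper (p h) → End (p h) c →
               ∃ λ f → f ≢ h × Proper (p f) × End (p f) c
  other-edge p h {c} even ph hc = f , f≢h , subst (λ cd → Proper cd × End cd c) (set-there p h (c , c) f≢h) f∋c
    where
    q = set p h (c , c)

    odd : parity q c ≡ true
    odd = begin
      parity q c                                        ≡⟨ parity-set p h (c , c) c ⟩
      parity p c xor (ends (p h) c xor (δ c c xor δ c c)) ≡⟨ cong₂ (λ s t → s xor (t xor (δ c c xor δ c c))) (even c) (ends-proper (p h) ph hc) ⟩
      true xor (δ c c xor δ c c)                        ≡⟨ cong (true xor_) (xor-same (δ c c)) ⟩
      true                                              ∎
      where open ≡-Reasoning

    f = proj₁ (⨁-true (λ g → ends (q g) c) odd)

    f∋c : Proper (q f) × End (q f) c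
    f∋c = ends-true (q f) (proj₂ (⨁-true (λ g → ends (q g) c) odd))

    f≢h : f ≢ h
    f≢h f≡h = proj₁ (subst Proper (trans (cong q f≡h) (set-here p h (c , c))) (proj₁ f∋c) , tt) refl

  -- Moving the odd degrees in a maximal choice

  module Maximal (p : Choice) (admissible : Admissible p) (even : Even p)
    (maximal : ∀ p′ → Admissible p′ → Even p′ → ¬ used p < used p′) where

    -- An admissible choice that leaves p unchanged off U, uses more edges than p
    -- and has odd degree exactly at x and y; for x = y it would beat p.
    record Reroute (U : Edge → Set) (x y : Vertex) : Set where
      field
        choice      : Choice
        admissible′ : Admissible choice
        agrees      : ∀ f → ¬ U f → choice f ≡ p f
        parity′     : ∀ v → parity choice v ≡ δ x v xor δ y v
        larger      : used p < used choice

    Reroute-irrefl : ∀ {U x} → ¬ Reroute U x x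
    Reroute-irrefl {x = x} r = maximal choice admissible′ (λ v → trans (parity′ v) (xor-same (δ x v))) larger
      where open Reroute r

    Reroute-sym : ∀ {U x y} → Reroute U x y → Reroute U y x
    Reroute-sym {x = x} {y} r = record
      { choice = choice ; admissible′ = admissible′ ; agrees = agrees
      ; parity′ = λ v → trans (parity′ v) (xor-comm (δ x v) (δ y v)) ; larger = larger }
      where open Reroute r

    Reroute-mono : ∀ {U U′ x y} → (∀ f → U f → U′ f) → Reroute U x y → Reroute U′ x y
    Reroute-mono U⊆U′ r = record
      { choice = choice ; admissible′ = admissible′ ; agrees = λ f ¬u → agrees f (¬u ∘ U⊆U′ f)
      ; parity′ = parity′ ; larger = larger }
      where open Reroute r

    _+ₑ_ : (Edge → Set) → Edge → Edge → Set
    (U +ₑ h) f = U f ⊎ f ≡ h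

    -- The rerouted choice still agrees with `p` on the unexplored edge `h`, so the change of parity
    -- at `h` can be computed from `p h`; the last hypothesis is this computation.
    modify : ∀ {U x y x′ y′} h a b → Reroute U x y → ¬ U h → Mem h a → Mem h b → a ≢ b →
             (∀ v → (δ x v xor δ y v) xor (ends (p h) v xor (δ a v xor δ b v)) ≡ δ x′ v xor δ y′ v) →
             Reroute (U +ₑ h) x′ y′
    modify {x = x} {y} h a b r h∉U ha hb a≢b eq = record
      { choice      = set choice h (a , b)
      ; admissible′ = admissible-set admissible′ ha hb
      ; agrees      = λ f f∉ → trans (set-there choice h (a , b) (f∉ ∘ inj₂)) (agrees f (f∉ ∘ inj₁))
      ; parity′     = λ v → trans (parity-set choice h (a , b) v)
          (trans (cong₂ (λ s t → s xor (ends t v xor (δ a v xor δ b v))) (parity′ v) (agrees h h∉U)) (eq v))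
      ; larger      = ≤-trans larger (used-set choice h a≢b)
      }
      where open Reroute r

    private
      module X = xor-∧-Solver
      open X using (_:+_; _:=_)

    Separated : Edge → Vertex → Vertex → Set
    Separated h x o = (End (p h) x × ¬ End (p h) o) ⊎ (¬ End (p h) x × End (p h) o)

    -- Of `x` and `o` exactly one is an end of `p h`; putting the other in its place changes the
    -- parity at these two vertices only. The case `o ≡ y` is deliberately allowed: the result is
    -- then refuted by `Reroute-irrefl`.
    toggle : ∀ {U x y h o} → Reroute U x y → ¬ U h → Proper (p h) → Mem h x → Mem h o →
             Separated h x o → Reroute (U +ₑ h) o y
    toggle {x = x} {y} {h} {o} r h∉U ph hx ho (inj₁ (inj₁ refl , o∉)) =
      modify h o b r h∉U ho (proj₂ (admissible h)) (o∉ ∘ inj₂)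
        λ v → X.solve 4 (λ a b y o → (a :+ y) :+ ((a :+ b) :+ (o :+ b)) := o :+ y) refl (δ x v) (δ b v) (δ y v) (δ o v)
      where b = proj₂ (p h)
    toggle {x = x} {y} {h} {o} r h∉U ph hx ho (inj₁ (inj₂ refl , o∉)) =
      modify h a o r h∉U (proj₁ (admissible h)) ho (o∉ ∘ inj₁ ∘ sym)
        λ v → X.solve 4 (λ a b y o → (b :+ y) :+ ((a :+ b) :+ (a :+ o)) := o :+ y) refl (δ a v) (δ x v) (δ y v) (δ o v)
      where a = proj₁ (p h)
    toggle {x = x} {y} {h} {o} r h∉U ph hx ho (inj₂ (x∉ , inj₁ refl)) =
      modify h x b r h∉U hx (proj₂ (admissible h)) (x∉ ∘ inj₂)
        λ v → X.solve 4 (λ x b y o → (x :+ y) :+ ((o :+ b) :+ (x :+ b)) := o :+ y) refl (δ x v) (δ b v) (δ y v) (δ o v)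
      where b = proj₂ (p h)
    toggle {x = x} {y} {h} {o} r h∉U ph hx ho (inj₂ (x∉ , inj₂ refl)) =
      modify h a x r h∉U (proj₁ (admissible h)) hx (x∉ ∘ inj₁ ∘ sym)
        λ v → X.solve 4 (λ a x y o → (x :+ y) :+ ((a :+ o) :+ (a :+ x)) := o :+ y) refl (δ a v) (δ x v) (δ y v) (δ o v)
      where a = proj₁ (p h)

    toggle-improper : ∀ {U x y h o} → Reroute U x y → ¬ U h → ¬ Proper (p h) → Mem h x → Mem h o →
                      x ≢ o → Reroute (U +ₑ h) o y
    toggle-improper {x = x} {y} {h} {o} r h∉U ¬ph hx ho x≢o =
      modify h x o r h∉U hx ho x≢o λ v → trans
        (cong (λ t → (δ x v xor δ y v) xor (t xor (δ x v xor δ o v))) (ends-improper (p h) ¬ph v))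
        (X.solve 3 (λ x y o → (x :+ y) :+ (x :+ o) := o :+ y) refl (δ x v) (δ y v) (δ o v))

    -- When p h = (x , y) it is replaced by (o , o′), when p h = (o , o′) by (x , y).
    exchange : ∀ {U x y h o o′} → Reroute U x y → ¬ U h → Proper (p h) → Mem h x → Mem h y → Mem h o → Mem h o′ →
               Separated h x o → Separated h x o′ → Separated h y o → x ≢ y → o ≢ o′ → Reroute (U +ₑ h) o o′
    exchange {x = x} {y} {h} {o} {o′} r h∉U ph hx hy ho ho′ (inj₁ (hx′ , o∉)) _ (inj₁ (hy′ , _)) x≢y o≢o′ =
      modify h o o′ r h∉U ho ho′ o≢o′ (λ v → trans
        (cong (λ t → (δ x v xor δ y v) xor (t xor (δ o v xor δ o′ v))) (both v hx′ hy′))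
        (X.solve 4 (λ x y o o′ → (x :+ y) :+ ((x :+ y) :+ (o :+ o′)) := o :+ o′) refl (δ x v) (δ y v) (δ o v) (δ o′ v)))
      where
      both : ∀ v → End (p h) x → End (p h) y → ends (p h) v ≡ δ x v xor δ y v
      both v (inj₁ refl) (inj₁ refl) = contradiction refl x≢y
      both v (inj₁ refl) (inj₂ refl) = refl
      both v (inj₂ refl) (inj₁ refl) = xor-comm (δ y v) (δ x v)
      both v (inj₂ refl) (inj₂ refl) = contradiction refl x≢y
    exchange r h∉U ph hx hy ho ho′ (inj₁ (_ , o∉)) _ (inj₂ (_ , o∈)) x≢y o≢o′ = contradiction o∈ o∉
    exchange r h∉U ph hx hy ho ho′ (inj₂ (_ , o∈)) _ (inj₁ (_ , o∉)) x≢y o≢o′ = contradiction o∈ o∉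
    exchange r h∉U ph hx hy ho ho′ (inj₂ (x∉ , _)) (inj₁ (x∈ , _)) _ x≢y o≢o′ = contradiction x∈ x∉
    exchange {x = x} {y} {h} {o} {o′} r h∉U ph hx hy ho ho′ (inj₂ (x∉ , ho″)) (inj₂ (_ , ho‴)) (inj₂ _) x≢y o≢o′ =
      modify h x y r h∉U hx hy x≢y (λ v → trans
        (cong (λ t → (δ x v xor δ y v) xor (t xor (δ x v xor δ y v))) (both v ho″ ho‴))
        (X.solve 4 (λ x y o o′ → (x :+ y) :+ ((o :+ o′) :+ (x :+ y)) := o :+ o′) refl (δ x v) (δ y v) (δ o v) (δ o′ v)))
      where
      both : ∀ v → End (p h) o → End (p h) o′ → ends (p h) v ≡ δ o v xor δ o′ v
      both v (inj₁ refl) (inj₁ refl) = contradiction refl o≢o′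
      both v (inj₁ refl) (inj₂ refl) = refl
      both v (inj₂ refl) (inj₁ refl) = xor-comm (δ o′ v) (δ o v)
      both v (inj₂ refl) (inj₂ refl) = contradiction refl o≢o′

    -- An explored edge is a petal with tip q if its vertices other than q lie in
    -- one class. It then contains pairs of different classes only through q.
    data Kind : Set where
      fresh full : Kind
      petal      : Vertex → Kind

    Explored : Kind → Set
    Explored fresh     = ⊥
    Explored full      = ⊤
    Explored (petal _) = ⊤

    Explored? : Decidable Explored
    Explored? fresh     = no id
    Explored? full      = yes tt
    Explored? (petal _) = yes tt

    -- A class is named by a vertex of the set (`root-in`), so a vertex outside can name a new class
    -- without a clash. `full-ends` serves the moment when a new vertex is followed along a second
    -- edge: that edge cannot be full, since its ends would be old.
    record Structure : Set₁ where
      field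
        In      : Vertex → Set
        In?     : Decidable In
        root    : Vertex → Vertex
        root-in : ∀ {x} → In x → In (root x)
        kind    : Edge → Kind

      explored : Edge → Set
      explored f = Explored (kind f)

      field
        reroute   : ∀ {x y} → In x → In y → root x ≢ root y → Reroute explored x y
        full-ends : ∀ f → kind f ≡ full → Proper (p f) → ∀ c → End (p f) c → In c
        petal-tip : ∀ f q → kind f ≡ petal q → Mem f q
        petal-rim : ∀ f q → kind f ≡ petal q → ∃ λ r → ∀ x → Mem f x → x ≢ q → In x × root x ≡ r

      Cross : Vertex → Vertex → Set
      Cross x y = In x × In y × root x ≢ root y

      Cross? : ∀ x y → Dec (Cross x y)
      Cross? x y = In? x ×-dec In? y ×-dec ¬? (root x ≟ root y)

      span : ℕ
      span = count In?

      pairs : ℕ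
      pairs = sum λ x → sum λ y → 𝟙 (Cross? x y)

      -- A bound for the ordered pairs of different classes in an edge (k - 1 = 2 + j).
      -- A petal whose tip is still outside carries the surplus k (k - 3); it is
      -- released when the tip joins, and pays for the edge that brought the tip in.
      kindCost : Kind → ℕ
      kindCost fresh     = 0
      kindCost full      = k * (2 + j)
      kindCost (petal q) = 2 * (2 + j) + 𝟙 (¬? (In? q)) * (k * j)

      cost : ℕ
      cost = sum (kindCost ∘ kind)

    -- Exploring one more edge: the effect on pairs and cost

    record Extension (S : Structure) : Set₁ where
      open Structure S
      field
        hub     : Edge
        hub-new : kind hub ≡ fresh
        New     : Vertex → Set
        New?    : Decidable New
        root′   : Vertex → Vertex
        kind′   : Kind
      In′ : Vertex → Set
      In′ x = In x ⊎ New x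
      newRoot : Vertex → Vertex
      newRoot x = if does (New? x) then root′ x else root x
      field
        explored′ : Explored kind′
        disjoint  : ∀ {o} → New o → ¬ In o
        root′-in  : ∀ {o} → New o → In′ (root′ o)
        reroute₁  : ∀ {o l} → New o → In l → root l ≢ root′ o → Reroute (explored +ₑ hub) o l
        reroute₂  : ∀ {o o′} → New o → New o′ → root′ o ≢ root′ o′ → Reroute (explored +ₑ hub) o o′
        full-ends′ : kind′ ≡ full → Proper (p hub) → ∀ c → End (p hub) c → In′ c
        petal-tip′ : ∀ q → kind′ ≡ petal q → Mem hub q
        petal-rim′ : ∀ q → kind′ ≡ petal q → ∃ λ r → ∀ x → Mem hub x → x ≢ q → In′ x × newRoot x ≡ r

    module Extend {S : Structure} (X : Extension S) where
      open Structure S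
      open Extension X

      newRoot-new : ∀ {x} → New x → newRoot x ≡ root′ x
      newRoot-new {x} nx with New? x
      ... | yes _ = refl
      ... | no ¬n = contradiction nx ¬n

      newRoot-old : ∀ {x} → In x → newRoot x ≡ root x
      newRoot-old {x} ix with New? x
      ... | yes nx = contradiction ix (disjoint nx)
      ... | no _   = refl

      newKind : Edge → Kind
      newKind f = if does (f ≟ hub) then kind′ else kind f

      newKind-there : ∀ {f} → f ≢ hub → newKind f ≡ kind f
      newKind-there {f} f≢ with f ≟ hub
      ... | yes p = contradiction p f≢
      ... | no _  = refl

      explored-mono : ∀ f → (explored +ₑ hub) f → Explored (newKind f)
      explored-mono f e with f ≟ hub
      explored-mono f e        | yes _ = explored′
      explored-mono f (inj₁ e) | no _  = e
      explored-mono f (inj₂ e) | no ¬p = contradiction e ¬p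

      extend : Structure
      extend .Structure.In      = In′
      extend .Structure.In? x   = In? x ⊎-dec New? x
      extend .Structure.root    = newRoot
      extend .Structure.root-in (inj₁ ix) rewrite newRoot-old ix = inj₁ (root-in ix)
      extend .Structure.root-in (inj₂ nx) rewrite newRoot-new nx = root′-in nx
      extend .Structure.kind    = newKind
      extend .Structure.reroute (inj₁ ix) (inj₁ iy) r≢ rewrite newRoot-old ix | newRoot-old iy =
        Reroute-mono (λ f → explored-mono f ∘ inj₁) (reroute ix iy r≢)
      extend .Structure.reroute (inj₁ ix) (inj₂ ny) r≢ rewrite newRoot-old ix | newRoot-new ny =
        Reroute-mono explored-mono (Reroute-sym (reroute₁ ny ix r≢))
      extend .Structure.reroute (inj₂ nx) (inj₁ iy) r≢ rewrite newRoot-new nx | newRoot-old iy =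
        Reroute-mono explored-mono (reroute₁ nx iy (r≢ ∘ sym))
      extend .Structure.reroute (inj₂ nx) (inj₂ ny) r≢ rewrite newRoot-new nx | newRoot-new ny =
        Reroute-mono explored-mono (reroute₂ nx ny r≢)
      extend .Structure.full-ends f eq with f ≟ hub
      ... | yes refl = full-ends′ eq
      ... | no _     = λ pf c fc → inj₁ (full-ends f eq pf c fc)
      extend .Structure.petal-tip f q eq with f ≟ hub
      ... | yes refl = petal-tip′ q eq
      ... | no _     = petal-tip f q eq
      extend .Structure.petal-rim f q eq with f ≟ hub
      ... | yes refl = petal-rim′ q eq
      ... | no _     = let r , rim = petal-rim f q eq in
        r , λ x fx x≢q → inj₁ (proj₁ (rim x fx x≢q)) , trans (newRoot-old (proj₁ (rim x fx x≢q))) (proj₂ (rim x fx x≢q))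

      private module S′ = Structure extend

      Cross-mono : ∀ {x y} → Cross x y → S′.Cross x y
      Cross-mono (ix , iy , r≢) = inj₁ ix , inj₁ iy , λ eq → r≢ (trans (sym (newRoot-old ix)) (trans eq (newRoot-old iy)))

      order-bound : span + count New? ≤ S′.span
      order-bound = ≤-trans (≤-reflexive (sym (∑-distrib-+ (𝟙 ∘ In?) (𝟙 ∘ New?))))
        (sum-mono-≤ λ x → 𝟙-disjoint (In? x) (New? x) (S′.In? x) inj₁ inj₂ λ ix nx → disjoint nx ix)

      private
        Far : Vertex → Vertex → Set
        Far x y = New x × In y × root y ≢ root′ x

        Far? : ∀ x y → Dec (Far x y)
        Far? x y = New? x ×-dec In? y ×-dec ¬? (root y ≟ root′ x)

        Both : Vertex → Vertex → Set
        Both x y = New x × New y × root′ x ≢ root′ y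

        Both? : ∀ x y → Dec (Both x y)
        Both? x y = New? x ×-dec New? y ×-dec ¬? (root′ x ≟ root′ y)

      farPairs bothPairs : ℕ
      farPairs  = sum λ x → sum λ y → 𝟙 (Far? x y)
      bothPairs = sum λ x → sum λ y → 𝟙 (Both? x y)

      -- Old pairs stay separated, and they are disjoint from the pairs of a new and an old vertex,
      -- which occur in both orders (hence the factor 2), and from the pairs of two new vertices.
      pairs-bound : pairs + 2 * farPairs + bothPairs ≤ S′.pairs
      pairs-bound = begin
        pairs + 2 * farPairs + bothPairs
          ≡⟨ cong (λ t → pairs + t + bothPairs) (cong (farPairs +_) (+-identityʳ farPairs)) ⟩
        pairs + (farPairs + farPairs) + bothPairs
          ≡⟨ cong (λ t → pairs + (farPairs + t) + bothPairs) (∑-comm (λ x y → 𝟙 (Far? x y))) ⟩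
        pairs + (farPairs + sum (λ x → sum λ y → 𝟙 (Far? y x))) + bothPairs
          ≡⟨ cong (λ t → pairs + t + bothPairs) (sym (∑∑-distrib-+ (λ x y → 𝟙 (Far? x y)) (λ x y → 𝟙 (Far? y x)))) ⟩
        pairs + sum (λ x → sum λ y → 𝟙 (Far? x y) + 𝟙 (Far? y x)) + bothPairs
          ≡⟨ cong (_+ bothPairs) (sym (∑∑-distrib-+ (λ x y → 𝟙 (Cross? x y)) (λ x y → 𝟙 (Far? x y) + 𝟙 (Far? y x)))) ⟩
        sum (λ x → sum λ y → 𝟙 (Cross? x y) + (𝟙 (Far? x y) + 𝟙 (Far? y x))) + bothPairs
          ≡⟨ sym (∑∑-distrib-+ (λ x y → 𝟙 (Cross? x y) + (𝟙 (Far? x y) + 𝟙 (Far? y x))) (λ x y → 𝟙 (Both? x y))) ⟩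
        sum (λ x → sum λ y → 𝟙 (Cross? x y) + (𝟙 (Far? x y) + 𝟙 (Far? y x)) + 𝟙 (Both? x y))
          ≤⟨ sum-mono-≤ (λ x → sum-mono-≤ (bound x)) ⟩
        S′.pairs ∎
        where
        open ≤-Reasoning

        bound : ∀ x y → 𝟙 (Cross? x y) + (𝟙 (Far? x y) + 𝟙 (Far? y x)) + 𝟙 (Both? x y) ≤ 𝟙 (S′.Cross? x y)
        bound x y = begin
          𝟙 (Cross? x y) + (𝟙 (Far? x y) + 𝟙 (Far? y x)) + 𝟙 (Both? x y)
            ≤⟨ +-monoˡ-≤ (𝟙 (Both? x y)) (+-monoʳ-≤ (𝟙 (Cross? x y)) (𝟙-disjoint (Far? x y) (Far? y x) F? inj₁ inj₂
                 λ (nx , _) (_ , ix , _) → disjoint nx ix)) ⟩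
          𝟙 (Cross? x y) + 𝟙 F? + 𝟙 (Both? x y)
            ≤⟨ +-monoˡ-≤ (𝟙 (Both? x y)) (𝟙-disjoint (Cross? x y) F? G? inj₁ inj₂
                 λ { (ix , _) (inj₁ (nx , _)) → disjoint nx ix ; (_ , iy , _) (inj₂ (ny , _)) → disjoint ny iy }) ⟩
          𝟙 G? + 𝟙 (Both? x y)
            ≤⟨ 𝟙-disjoint G? (Both? x y) (S′.Cross? x y) crossing
                 (λ (nx , ny , r≢) → inj₂ nx , inj₂ ny , λ eq → r≢ (trans (sym (newRoot-new nx)) (trans eq (newRoot-new ny))))
                 (λ { (inj₁ (ix , _)) (nx , _) → disjoint nx ix
                    ; (inj₂ (inj₁ (_ , iy , _))) (_ , ny , _) → disjoint ny iy
                    ; (inj₂ (inj₂ (_ , ix , _))) (nx , _) → disjoint nx ix }) ⟩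
          𝟙 (S′.Cross? x y) ∎
          where
          F? = Far? x y ⊎-dec Far? y x
          G? = Cross? x y ⊎-dec F?

          crossing : Cross x y ⊎ (Far x y ⊎ Far y x) → S′.Cross x y
          crossing (inj₁ c) = Cross-mono c
          crossing (inj₂ (inj₁ (nx , iy , r≢))) = inj₂ nx , inj₁ iy , λ eq → r≢ (trans (sym (newRoot-old iy)) (trans (sym eq) (newRoot-new nx)))
          crossing (inj₂ (inj₂ (ny , ix , r≢))) = inj₁ ix , inj₂ ny , λ eq → r≢ (trans (sym (newRoot-old ix)) (trans eq (newRoot-new ny)))

      kindCost-mono : ∀ κ → S′.kindCost κ ≤ kindCost κ
      kindCost-mono fresh     = z≤n
      kindCost-mono full      = ≤-refl
      kindCost-mono (petal q) = +-monoʳ-≤ (2 * (2 + j)) (*-monoˡ-≤ (k * j)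
        (𝟙-mono (¬? (S′.In? q)) (¬? (In? q)) (_∘ inj₁)))

      cost-at : ∀ f → S′.kindCost (newKind f) ≤ kindCost (kind f) + 𝟙 (hub ≟ f) * S′.kindCost kind′
      cost-at f with f ≟ hub
      ... | yes refl rewrite 𝟙-yes (hub ≟ hub) refl | hub-new = m≤m+n _ _
      ... | no _     = ≤-trans (kindCost-mono (kind f)) (m≤m+n _ _)

      private
        δ-sum : ∀ (g : Edge) c → sum (λ f → 𝟙 (g ≟ f) * c) ≡ c
        δ-sum g c = trans (sym (*-distribʳ-sum c (λ f → 𝟙 (g ≟ f)))) (trans (cong (_* c) (count-≟ g)) (*-identityˡ c))

      cost-bound : S′.cost ≤ cost + S′.kindCost kind′
      cost-bound = begin
        S′.cost                                                                 ≤⟨ sum-mono-≤ cost-at ⟩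
        sum (λ f → kindCost (kind f) + 𝟙 (hub ≟ f) * S′.kindCost kind′)         ≡⟨ ∑-distrib-+ (kindCost ∘ kind) (λ f → 𝟙 (hub ≟ f) * S′.kindCost kind′) ⟩
        cost + sum (λ f → 𝟙 (hub ≟ f) * S′.kindCost kind′)                      ≡⟨ cong (cost +_) (δ-sum hub _) ⟩
        cost + S′.kindCost kind′                                                ∎
        where open ≤-Reasoning

      -- As `q` joins, the indicator in the cost of the petal `f` drops from 1 to 0. The edge `f` is
      -- not `hub`, which was fresh, so this saving comes on top of the price of `hub`.
      cost-bound-closing : ∀ f q → kind f ≡ petal q → New q → S′.cost + k * j ≤ cost + S′.kindCost kind′
      cost-bound-closing g q g-petal nq = begin
        S′.cost + k * j                                                   ≡⟨ cong (S′.cost +_) (sym (δ-sum g (k * j))) ⟩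
        S′.cost + sum (λ f → 𝟙 (g ≟ f) * (k * j))                         ≡⟨ sym (∑-distrib-+ (S′.kindCost ∘ newKind) (λ f → 𝟙 (g ≟ f) * (k * j))) ⟩
        sum (λ f → S′.kindCost (newKind f) + 𝟙 (g ≟ f) * (k * j))         ≤⟨ sum-mono-≤ closing ⟩
        sum (λ f → kindCost (kind f) + 𝟙 (hub ≟ f) * S′.kindCost kind′)   ≡⟨ ∑-distrib-+ (kindCost ∘ kind) (λ f → 𝟙 (hub ≟ f) * S′.kindCost kind′) ⟩
        cost + sum (λ f → 𝟙 (hub ≟ f) * S′.kindCost kind′)                ≡⟨ cong (cost +_) (δ-sum hub _) ⟩
        cost + S′.kindCost kind′                                          ∎
        where
        open ≤-Reasoning

        g≢hub : g ≢ hub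
        g≢hub refl with trans (sym hub-new) g-petal
        ... | ()

        closing : ∀ f → S′.kindCost (newKind f) + 𝟙 (g ≟ f) * (k * j) ≤ kindCost (kind f) + 𝟙 (hub ≟ f) * S′.kindCost kind′
        closing f with g ≟ f
        ... | no _ = ≤-trans (≤-reflexive (+-identityʳ _)) (cost-at f)
        ... | yes refl rewrite newKind-there g≢hub | g-petal
                             | 𝟙-no (¬? (S′.In? q)) (λ ¬i → ¬i (inj₂ nq)) | 𝟙-yes (¬? (In? q)) (disjoint nq) =
          ≤-trans (≤-reflexive (cong (_+ 1 * (k * j)) (+-identityʳ (2 * (2 + j))))) (m≤m+n _ _)

    Separated? : ∀ h x o → Dec (Separated h x o)
    Separated? h x o = (End? (p h) x ×-dec ¬? (End? (p h) o)) ⊎-dec (¬? (End? (p h) x) ×-dec End? (p h) o)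

    -- Double counting of pairs in explored edges

    rest : ∀ f {q} → Mem f q → count (λ y → Mem? f y ×-dec ¬? (y ≟ q)) ≡ 2 + j
    rest f {q} fq = +-cancelʳ-≡ 1 _ _ (begin
      count (λ y → Mem? f y ×-dec ¬? (y ≟ q)) + 1            ≡⟨ cong (count (λ y → Mem? f y ×-dec ¬? (y ≟ q)) +_) (sym (count-≟ q)) ⟩
      count (λ y → Mem? f y ×-dec ¬? (y ≟ q)) + count (q ≟_) ≡⟨ sym (∑-distrib-+ (λ y → 𝟙 (Mem? f y ×-dec ¬? (y ≟ q))) (𝟙 ∘ (q ≟_))) ⟩
      sum (λ y → 𝟙 (Mem? f y ×-dec ¬? (y ≟ q)) + 𝟙 (q ≟ y))  ≡⟨ sum-cong-≗ split ⟩
      count (Mem? f)                                         ≡⟨ trans (card f) (+-comm 1 (2 + j)) ⟩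
      2 + j + 1                                              ∎)
      where
      open ≡-Reasoning

      split : ∀ y → 𝟙 (Mem? f y ×-dec ¬? (y ≟ q)) + 𝟙 (q ≟ y) ≡ 𝟙 (Mem? f y)
      split y = ≤-antisym
        (𝟙-disjoint (Mem? f y ×-dec ¬? (y ≟ q)) (q ≟ y) (Mem? f y) proj₁ (λ { refl → fq }) (λ (_ , y≢q) q≡y → y≢q (sym q≡y)))
        (𝟙-union (Mem? f y ×-dec ¬? (y ≟ q)) (q ≟ y) (Mem? f y) cases)
        where
        cases : Mem f y → (Mem f y × y ≢ q) ⊎ q ≡ y
        cases fy with y ≟ q
        ... | yes y≡q = inj₂ (sym y≡q)
        ... | no y≢q  = inj₁ (fy , y≢q)

    pairsIn : ∀ f → sum (λ x → sum λ y → 𝟙 (Mem? f x ×-dec (Mem? f y ×-dec ¬? (y ≟ x)))) ≡ k * (2 + j)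
    pairsIn f = begin
      sum (λ x → sum λ y → 𝟙 (Mem? f x ×-dec (Mem? f y ×-dec ¬? (y ≟ x)))) ≡⟨ sum-cong-≗ row ⟩
      sum (λ x → 𝟙 (Mem? f x) * (2 + j))                                   ≡⟨ sym (*-distribʳ-sum (2 + j) (𝟙 ∘ Mem? f)) ⟩
      count (Mem? f) * (2 + j)                                             ≡⟨ cong (_* (2 + j)) (card f) ⟩
      k * (2 + j)                                                          ∎
      where
      open ≡-Reasoning

      row : ∀ x → sum (λ y → 𝟙 (Mem? f x ×-dec (Mem? f y ×-dec ¬? (y ≟ x)))) ≡ 𝟙 (Mem? f x) * (2 + j)
      row x = begin
        sum (λ y → 𝟙 (Mem? f x ×-dec (Mem? f y ×-dec ¬? (y ≟ x))))   ≡⟨ sum-cong-≗ (λ y → 𝟙-× (Mem? f x) (Mem? f y ×-dec ¬? (y ≟ x))) ⟩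
        sum (λ y → 𝟙 (Mem? f x) * 𝟙 (Mem? f y ×-dec ¬? (y ≟ x)))     ≡⟨ sym (*-distribˡ-sum (𝟙 (Mem? f x)) (λ y → 𝟙 (Mem? f y ×-dec ¬? (y ≟ x)))) ⟩
        𝟙 (Mem? f x) * count (λ y → Mem? f y ×-dec ¬? (y ≟ x))       ≡⟨ last (Mem? f x) ⟩
        𝟙 (Mem? f x) * (2 + j)                                       ∎
        where
        last : (fx? : Dec (Mem f x)) → 𝟙 fx? * count (λ y → Mem? f y ×-dec ¬? (y ≟ x)) ≡ 𝟙 fx? * (2 + j)
        last (yes fx) = cong (1 *_) (rest f fx)
        last (no _)   = refl

    module Coverage (S : Structure) where
      open Structure S

      Covers : Edge → Vertex → Vertex → Set
      Covers f x y = explored f × Mem f x × Mem f y × Cross x y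

      Covers? : ∀ f x y → Dec (Covers f x y)
      Covers? f x y = Explored? (kind f) ×-dec Mem? f x ×-dec Mem? f y ×-dec Cross? x y

      cross-≢ : ∀ {x y} → Cross x y → x ≢ y
      cross-≢ (_ , _ , r≢) x≡y = r≢ (cong root x≡y)

      covers-bound : ∀ f → sum (λ x → sum λ y → 𝟙 (Covers? f x y)) ≤ kindCost (kind f)
      covers-bound f with kind f in eq
      ... | fresh = ≤-reflexive (trans (sum-cong-≗ {n} λ x → sum-zeros n) (sum-zeros n))
      ... | full = ≤-trans
        (sum-mono-≤ λ x → sum-mono-≤ λ y →
          𝟙-mono (yes tt ×-dec Mem? f x ×-dec Mem? f y ×-dec Cross? x y) (Mem? f x ×-dec (Mem? f y ×-dec ¬? (y ≟ x)))
            λ (_ , fx , fy , c) → fx , fy , cross-≢ c ∘ sym)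
        (≤-reflexive (pairsIn f))
      ... | petal q = begin
        sum (λ x → sum λ y → 𝟙 (yes tt ×-dec Mem? f x ×-dec Mem? f y ×-dec Cross? x y))
          ≤⟨ sum-mono-≤ (λ x → sum-mono-≤ (through x)) ⟩
        sum (λ x → sum λ y → 𝟙 (q ≟ x) * 𝟙 (R? y) + 𝟙 (R? x) * 𝟙 (q ≟ y))
          ≡⟨ ∑∑-distrib-+ (λ x y → 𝟙 (q ≟ x) * 𝟙 (R? y)) (λ x y → 𝟙 (R? x) * 𝟙 (q ≟ y)) ⟩
        sum (λ x → sum λ y → 𝟙 (q ≟ x) * 𝟙 (R? y)) + sum (λ x → sum λ y → 𝟙 (R? x) * 𝟙 (q ≟ y))
          ≡⟨ cong₂ _+_ (sum-* (𝟙 ∘ (q ≟_)) (𝟙 ∘ R?)) (sum-* (𝟙 ∘ R?) (𝟙 ∘ (q ≟_))) ⟩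
        count (q ≟_) * count R? + count R? * count (q ≟_)
          ≡⟨ cong₂ (λ s t → s * t + t * s) (count-≟ q) (rest f (petal-tip f q eq)) ⟩
        1 * (2 + j) + (2 + j) * 1
          ≡⟨ cong (1 * (2 + j) +_) (*-comm (2 + j) 1) ⟩
        1 * (2 + j) + 1 * (2 + j)
          ≡⟨ double (2 + j) ⟩
        2 * (2 + j)
          ≤⟨ m≤m+n _ _ ⟩
        2 * (2 + j) + 𝟙 (¬? (In? q)) * (k * j) ∎
        where
        open ≤-Reasoning

        double : ∀ s → 1 * s + 1 * s ≡ 2 * s
        double = solve-∀

        R? : ∀ y → Dec (Mem f y × y ≢ q)
        R? y = Mem? f y ×-dec ¬? (y ≟ q)

        tip : ∀ {x y} → Mem f x → Mem f y → Cross x y → (q ≡ x × (Mem f y × y ≢ q)) ⊎ ((Mem f x × x ≢ q) × q ≡ y)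
        tip {x} {y} fx fy c@(_ , _ , r≢) with x ≟ q | y ≟ q
        ... | yes refl | yes refl = contradiction refl (cross-≢ c)
        ... | yes refl | no y≢q   = inj₁ (refl , fy , y≢q)
        ... | no x≢q   | yes refl = inj₂ ((fx , x≢q) , refl)
        ... | no x≢q   | no y≢q   = let r , rim = petal-rim f q eq in
          contradiction (trans (proj₂ (rim x fx x≢q)) (sym (proj₂ (rim y fy y≢q)))) r≢

        through : ∀ x y → 𝟙 (yes tt ×-dec Mem? f x ×-dec Mem? f y ×-dec Cross? x y) ≤
                          𝟙 (q ≟ x) * 𝟙 (R? y) + 𝟙 (R? x) * 𝟙 (q ≟ y)
        through x y = ≤-trans
          (𝟙-union ((q ≟ x) ×-dec R? y) (R? x ×-dec (q ≟ y)) (yes tt ×-dec Mem? f x ×-dec Mem? f y ×-dec Cross? x y)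
            λ (_ , fx , fy , c) → tip fx fy c)
          (≤-reflexive (cong₂ _+_ (𝟙-× (q ≟ x) (R? y)) (𝟙-× (R? x) (q ≟ y))))

      private
        covers-total : sum (λ x → sum λ y → sum λ f → 𝟙 (Covers? f x y)) ≤ cost
        covers-total = begin
          sum (λ x → sum λ y → sum λ f → 𝟙 (Covers? f x y)) ≡⟨ sum-cong-≗ (λ x → ∑-comm (λ y f → 𝟙 (Covers? f x y))) ⟩
          sum (λ x → sum λ f → sum λ y → 𝟙 (Covers? f x y)) ≡⟨ ∑-comm (λ x f → sum λ y → 𝟙 (Covers? f x y)) ⟩
          sum (λ f → sum λ x → sum λ y → 𝟙 (Covers? f x y)) ≤⟨ sum-mono-≤ covers-bound ⟩
          cost                                              ∎
          where open ≤-Reasoning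

        Covered : Set
        Covered = ∀ x y → Cross x y → ∃ λ f → Covers f x y

        once : Covered → ∀ x y → 𝟙 (Cross? x y) ≤ sum λ f → 𝟙 (Covers? f x y)
        once all x y = 𝟙-≤ (Cross? x y) λ c → let f , fc = all x y c in
          ≤-trans (≤-reflexive (sym (𝟙-yes (Covers? f x y) fc))) (≤-sum (λ f → 𝟙 (Covers? f x y)) f)

        covered-≤ : Covered → pairs ≤ cost
        covered-≤ all = ≤-trans (sum-mono-≤ λ x → sum-mono-≤ (once all x)) covers-total

        -- The count is strict because the pair `(x , y)` is counted once for `f` and once for `g`.
        covered-< : Covered → ∀ {x y f g} → f ≢ g → Covers f x y → Covers g x y → pairs < cost
        covered-< all {x} {y} {f} {g} f≢g fc gc =
          ≤-trans (sum-mono-< (λ x → sum-mono-≤ (once all x)) x (sum-mono-< (once all x) y twice)) covers-total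
          where
          open ≤-Reasoning

          twice : 𝟙 (Cross? x y) < sum λ f → 𝟙 (Covers? f x y)
          twice = begin-strict
            𝟙 (Cross? x y)                           <⟨ s≤s (𝟙≤1 (Cross? x y)) ⟩
            1 + 1                                    ≡⟨ cong₂ _+_ (sym (count-≟ f)) (sym (count-≟ g)) ⟩
            count (f ≟_) + count (g ≟_)              ≡⟨ sym (∑-distrib-+ (𝟙 ∘ (f ≟_)) (𝟙 ∘ (g ≟_))) ⟩
            sum (λ h → 𝟙 (f ≟ h) + 𝟙 (g ≟ h))        ≤⟨ sum-mono-≤ (λ h → 𝟙-disjoint (f ≟ h) (g ≟ h) (Covers? h x y)
                                                          (λ { refl → fc }) (λ { refl → gc }) λ { refl g≡f → f≢g (sym g≡f) }) ⟩
            sum (λ h → 𝟙 (Covers? h x y))            ∎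

      Open : Set
      Open = ∃ λ h → ∃₂ λ x y → kind h ≡ fresh × Mem h x × Mem h y × Cross x y

      private
        -- A pair in different classes lies in some edge by `cover`; if no explored edge contains
        -- the pair, that edge is fresh.
        open-or-covered : Open ⊎ Covered
        open-or-covered with any? (λ x → any? λ y → Cross? x y ×-dec ¬? (any? λ f → Covers? f x y))
        ... | no ¬ex = inj₂ λ x y c → case any? (λ f → Covers? f x y) of λ
          { (yes fc) → fc ; (no ¬fc) → contradiction (x , y , c , ¬fc) ¬ex }
        ... | yes (x , y , c , ¬fc) with cover (cross-≢ c)
        ...   | h , hx , hy with kind h in eq
        ...     | fresh   = inj₁ (h , x , y , eq , hx , hy , c)
        ...     | full    = contradiction (h , subst Explored (sym eq) tt , hx , hy , c) ¬fc
        ...     | petal q = contradiction (h , subst Explored (sym eq) tt , hx , hy , c) ¬fc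

      open-< : cost < pairs → Open
      open-< lt with open-or-covered
      ... | inj₁ o   = o
      ... | inj₂ all = contradiction (covered-≤ all) (<⇒≱ lt)

      open-≤ : cost ≤ pairs → ∀ {x y f g} → f ≢ g → Covers f x y → Covers g x y → Open
      open-≤ le f≢g fc gc with open-or-covered
      ... | inj₁ o   = o
      ... | inj₂ all = contradiction (covered-< all f≢g fc gc) (≤⇒≯ le)

    -- The growth step and its balance

    open Structure using (span; pairs; cost; kind; In)

    -- With subtraction, `gain` says that `pairs` minus `cost` rises by at least 2(`span S` - k).
    -- This rate is dictated by k = 3: one new vertex then brings 2 `span S` pairs, while its edge
    -- costs 2k = k(k - 1).
    record Grown (S S′ : Structure) (h : Edge) : Set where
      field
        gain         : pairs S + cost S′ + 2 * span S ≤ pairs S′ + cost S + 2 * k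
        bigger       : span S < span S′
        keepCross    : ∀ {x y} → Structure.Cross S x y → Structure.Cross S′ x y
        keepExplored : ∀ {f} → Structure.explored S f → Structure.explored S′ f
        explored-hub : Structure.explored S′ h

    -- All new vertices join the class of `c`. They need no reroutes to each other or into that
    -- class, and gain pairs only with the vertices outside it.
    module Attach (S : Structure) (h : Edge) (h-new : kind S h ≡ fresh) (c : Vertex) (c-in : In S c)
      (N : Vertex → Set) (N? : Decidable N) (N-new : ∀ {o} → N o → ¬ In S o) (κ : Kind) (κ-explored : Explored κ)
      (reach : ∀ {o l} → N o → In S l → Structure.root S l ≢ Structure.root S c →
               Reroute (Structure.explored S +ₑ h) o l)
      (full-ends : κ ≡ full → Proper (p h) → ∀ v → End (p h) v → In S v ⊎ N v)
      (petal-tip : ∀ q → κ ≡ petal q → Mem h q)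
      (petal-rim : ∀ q → κ ≡ petal q → ∀ v → Mem h v → v ≢ q →
                   (In S v × Structure.root S v ≡ Structure.root S c) ⊎ N v)
      where
      private module S = Structure S

      extension : Extension S
      extension .Extension.hub       = h
      extension .Extension.hub-new   = h-new
      extension .Extension.New       = N
      extension .Extension.New?      = N?
      extension .Extension.root′ _   = S.root c
      extension .Extension.kind′     = κ
      extension .Extension.explored′ = κ-explored
      extension .Extension.disjoint  = N-new
      extension .Extension.root′-in _ = inj₁ (S.root-in c-in)
      extension .Extension.reroute₁  = reach
      extension .Extension.reroute₂ _ _ r≢ = contradiction refl r≢
      extension .Extension.full-ends′ = full-ends
      extension .Extension.petal-tip′ = petal-tip
      extension .Extension.petal-rim′ q eq = S.root c , λ v hv v≢q → [ (λ (iv , rv) → inj₁ iv , old iv rv) , (λ nv → inj₂ nv , new nv) ]′ (petal-rim q eq v hv v≢q)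
        where
        new : ∀ {v} → N v → (if does (N? v) then S.root c else S.root v) ≡ S.root c
        new {v} nv with N? v
        ... | yes _ = refl
        ... | no ¬n = contradiction nv ¬n

        old : ∀ {v} → S.In v → S.root v ≡ S.root c → (if does (N? v) then S.root c else S.root v) ≡ S.root c
        old {v} iv rv with N? v
        ... | yes nv = contradiction iv (N-new nv)
        ... | no _   = rv

      open Extend extension public

      Outside? : Decidable (λ l → S.In l × S.root l ≢ S.root c)
      Outside? l = S.In? l ×-dec ¬? (S.root l ≟ S.root c)

      attach-pairs : S.pairs + 2 * (count N? * count Outside?) ≤ pairs extend
      attach-pairs = ≤-trans (+-monoʳ-≤ S.pairs (*-monoʳ-≤ 2 far)) (≤-trans (m≤m+n _ bothPairs) pairs-bound)
        where
        far : count N? * count Outside? ≤ farPairs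
        far = ≤-trans (≤-reflexive (sym (sum-* (𝟙 ∘ N?) (𝟙 ∘ Outside?))))
          (sum-mono-≤ λ x → sum-mono-≤ λ y → ≤-reflexive (sym (𝟙-× (N? x) (Outside? y))))

    Inner? : ∀ h ab v → Dec (Mem h v × ¬ End ab v)
    Inner? h ab v = Mem? h v ×-dec ¬? (End? ab v)

    inner : ∀ h ab → 1 + j ≤ count (Inner? h ab)
    inner h (a , b) = +-cancelʳ-≤ 2 (1 + j) (count I?) (begin
      1 + j + 2                                       ≡⟨ +-comm (1 + j) 2 ⟩
      k                                               ≡⟨ sym (card h) ⟩
      count (Mem? h)                                  ≤⟨ sum-mono-≤ split ⟩
      sum (λ v → 𝟙 (I? v) + (𝟙 (a ≟ v) + 𝟙 (b ≟ v)))  ≡⟨ ∑-distrib-+ (𝟙 ∘ I?) (λ v → 𝟙 (a ≟ v) + 𝟙 (b ≟ v)) ⟩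
      count I? + sum (λ v → 𝟙 (a ≟ v) + 𝟙 (b ≟ v))    ≡⟨ cong (count I? +_) (∑-distrib-+ (𝟙 ∘ (a ≟_)) (𝟙 ∘ (b ≟_))) ⟩
      count I? + (count (a ≟_) + count (b ≟_))        ≡⟨ cong (count I? +_) (cong₂ _+_ (count-≟ a) (count-≟ b)) ⟩
      count I? + 2                                    ∎)
      where
      open ≤-Reasoning
      I? = Inner? h (a , b)

      cases : ∀ v → Mem h v → (Mem h v × ¬ End (a , b) v) ⊎ (a ≡ v ⊎ b ≡ v)
      cases v hv with End? (a , b) v
      ... | yes (inj₁ v≡a) = inj₂ (inj₁ (sym v≡a))
      ... | yes (inj₂ v≡b) = inj₂ (inj₂ (sym v≡b))
      ... | no v∉          = inj₁ (hv , v∉)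

      split : ∀ v → 𝟙 (Mem? h v) ≤ 𝟙 (I? v) + (𝟙 (a ≟ v) + 𝟙 (b ≟ v))
      split v = ≤-trans (𝟙-union (I? v) (a ≟ v ⊎-dec b ≟ v) (Mem? h v) (cases v))
        (+-monoʳ-≤ (𝟙 (I? v)) (𝟙-union (a ≟ v) (b ≟ v) (a ≟ v ⊎-dec b ≟ v) id))

    pair-size : ∀ {P : Vertex → Set} (P? : Decidable P) ab → Proper ab → (∀ {v} → End ab v → P v) → 2 ≤ count P?
    pair-size P? (a , b) a≢b ends⊆ = begin
      2                                     ≡⟨ sym (cong₂ _+_ (count-≟ a) (count-≟ b)) ⟩
      count (a ≟_) + count (b ≟_)           ≡⟨ sym (∑-distrib-+ (𝟙 ∘ (a ≟_)) (𝟙 ∘ (b ≟_))) ⟩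
      sum (λ v → 𝟙 (a ≟ v) + 𝟙 (b ≟ v))     ≤⟨ sum-mono-≤ (λ v → 𝟙-disjoint (a ≟ v) (b ≟ v) (P? v)
        (ends⊆ ∘ inj₁ ∘ sym) (ends⊆ ∘ inj₂ ∘ sym) λ a≡v b≡v → a≢b (trans a≡v (sym b≡v))) ⟩
      count P?                              ∎
      where open ≤-Reasoning

    end-mem : ∀ {f c} → End (p f) c → Mem f c
    end-mem {f} (inj₁ refl) = proj₁ (admissible f)
    end-mem {f} (inj₂ refl) = proj₂ (admissible f)

    other-end : ∀ f {c} → Proper (p f) → End (p f) c →
                ∃ λ q → End (p f) q × c ≢ q × (∀ {v} → End (p f) v → v ≡ c ⊎ v ≡ q)
    other-end f pf (inj₁ refl) = _ , inj₂ refl , pf , id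
    other-end f pf (inj₂ refl) = _ , inj₁ refl , pf ∘ sym , [ inj₂ , inj₁ ]′

    -- Here every new vertex founds a class of its own. This is possible because the edge reroutes
    -- to any two of them at once, by `exchange`.
    module AddSide (S : Structure) {h x y} (h-new : kind S h ≡ fresh) (hx : Mem h x) (hy : Mem h y)
      (cross : Structure.Cross S x y) where
      open Structure S hiding (span; pairs; cost; kind; In)

      private
        ix = proj₁ cross
        iy = proj₁ (proj₂ cross)
        x≁y = proj₂ (proj₂ cross)

        x≢y : x ≢ y
        x≢y eq = x≁y (cong root eq)

        h∉ : ¬ explored h
        h∉ e = subst Explored h-new e

        xy : Reroute explored x y
        xy = reroute ix iy x≁y

      proper : Proper (p h)
      proper with Proper? (p h)
      ... | yes ph = ph
      ... | no ¬ph = ⊥-elim (Reroute-irrefl (toggle-improper xy h∉ ¬ph hx hy x≢y))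

      unseparated : ¬ Separated h x y
      unseparated sep = Reroute-irrefl (toggle xy h∉ proper hx hy sep)

      same-side : ∀ {o} → Separated h x o → Separated h y o
      same-side {o} (inj₁ (x∈ , o∉)) with End? (p h) y
      ... | yes y∈ = inj₁ (y∈ , o∉)
      ... | no y∉  = contradiction (inj₁ (x∈ , y∉)) unseparated
      same-side {o} (inj₂ (x∉ , o∈)) with End? (p h) y
      ... | yes y∈ = contradiction (inj₂ (x∉ , y∈)) unseparated
      ... | no y∉  = inj₂ (y∉ , o∈)

      Side : Vertex → Set
      Side o = Mem h o × Separated h x o

      Side? : Decidable Side
      Side? o = Mem? h o ×-dec Separated? h x o

      -- The vertex `l` cannot be in the classes of both `x` and `y`. The reroute starts from
      -- whichever of the two is in another class; both lie on the same side of `p h`. For `l ≡ o`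
      -- it follows that `o` is new.
      reach : ∀ {o l} → Side o → In S l → Reroute (explored +ₑ h) o l
      reach {o} {l} (ho , sep) il with root x ≟ root l
      ... | no x≁l  = toggle (reroute ix il x≁l) h∉ proper hx ho sep
      ... | yes x∼l = toggle (reroute iy il λ y∼l → x≁y (trans x∼l (sym y∼l))) h∉ proper hy ho (same-side sep)

      side-new : ∀ {o} → Side o → ¬ In S o
      side-new so io = Reroute-irrefl (reach so io)

      extension : Extension S
      extension .Extension.hub        = h
      extension .Extension.hub-new    = h-new
      extension .Extension.New        = Side
      extension .Extension.New?       = Side?
      extension .Extension.root′ o    = o
      extension .Extension.kind′      = full
      extension .Extension.explored′  = tt
      extension .Extension.disjoint   = side-new
      extension .Extension.root′-in   = inj₂
      extension .Extension.reroute₁ so il _ = reach so il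
      extension .Extension.reroute₂ (ho , sep) (ho′ , sep′) o≢o′ =
        exchange xy h∉ proper hx hy ho ho′ sep sep′ (same-side sep) x≢y o≢o′
      extension .Extension.full-ends′ _ _ c c∈ with End? (p h) x
      ... | no x∉ = inj₂ (end-mem {h} c∈ , inj₂ (x∉ , c∈))
      ... | yes x∈ with End? (p h) y
      ...   | no y∉  = contradiction (inj₁ (x∈ , y∉)) unseparated
      ...   | yes y∈ = inj₁ (two x∈ y∈ c∈)
        where
        two : ∀ {c} → End (p h) x → End (p h) y → End (p h) c → In S c
        two (inj₁ refl) _           (inj₁ refl) = ix
        two (inj₂ refl) _           (inj₂ refl) = ix
        two _           (inj₁ refl) (inj₁ refl) = iy
        two _           (inj₂ refl) (inj₂ refl) = iy
        two (inj₁ x≡a)  (inj₁ y≡a)  (inj₂ _)    = contradiction (trans x≡a (sym y≡a)) x≢y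
        two (inj₂ x≡b)  (inj₂ y≡b)  (inj₁ _)    = contradiction (trans x≡b (sym y≡b)) x≢y
      extension .Extension.petal-tip′ _ ()
      extension .Extension.petal-rim′ _ ()

      open Extend extension public

      -- A new vertex differs from every old root, since roots lie in the set, so it forms pairs
      -- with all old vertices, and new vertices form pairs among themselves. Lower bounds `s` and
      -- `w` suffice for the counts below.
      side-pairs : ∀ {s w} → s ≤ count Side? → w ≤ span S →
                   pairs S + 2 * (s * w) + s * (s ∸ 1) ≤ pairs extend
      side-pairs {s} {w} s≤ w≤ = ≤-trans (+-mono-≤ (+-monoʳ-≤ (pairs S) (*-monoʳ-≤ 2 (≤-trans (*-mono-≤ s≤ w≤) far)))
                                              (≤-trans (*-mono-≤ s≤ (∸-monoˡ-≤ 1 s≤)) both)) pairs-bound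
        where
        N = count Side?

        far : N * span S ≤ farPairs
        far = ≤-trans (≤-reflexive (sym (sum-* (𝟙 ∘ Side?) (𝟙 ∘ In?))))
          (sum-mono-≤ λ u → sum-mono-≤ λ v → ≤-trans (≤-reflexive (sym (𝟙-× (Side? u) (In? v))))
            (𝟙-mono (Side? u ×-dec In? v) (Side? u ×-dec In? v ×-dec ¬? (root v ≟ u))
              λ (su , iv) → su , iv , λ r≡u → side-new su (subst (In S) r≡u (root-in iv))))

        square : N * N ≤ N + bothPairs
        square = begin
          N * N
            ≡⟨ sym (sum-* (𝟙 ∘ Side?) (𝟙 ∘ Side?)) ⟩
          sum (λ u → sum λ v → 𝟙 (Side? u) * 𝟙 (Side? v))
            ≤⟨ sum-mono-≤ (λ u → sum-mono-≤ λ v → split u v) ⟩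
          sum (λ u → sum λ v → 𝟙 (Side? u) * 𝟙 (u ≟ v) + 𝟙 (B? u v))
            ≡⟨ ∑∑-distrib-+ (λ u v → 𝟙 (Side? u) * 𝟙 (u ≟ v)) (λ u v → 𝟙 (B? u v)) ⟩
          sum (λ u → sum λ v → 𝟙 (Side? u) * 𝟙 (u ≟ v)) + bothPairs
            ≡⟨ cong (_+ bothPairs) (sum-cong-≗ λ u → trans (sym (*-distribˡ-sum (𝟙 (Side? u)) (𝟙 ∘ (u ≟_))))
                 (trans (cong (𝟙 (Side? u) *_) (count-≟ u)) (*-identityʳ _))) ⟩
          N + bothPairs ∎
          where
          open ≤-Reasoning

          B? : ∀ u v → Dec (Side u × Side v × u ≢ v)
          B? u v = Side? u ×-dec Side? v ×-dec ¬? (u ≟ v)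

          cases : ∀ u v → Side u × Side v → (Side u × u ≡ v) ⊎ (Side u × Side v × u ≢ v)
          cases u v (su , sv) with u ≟ v
          ... | yes u≡v = inj₁ (su , u≡v)
          ... | no u≢v  = inj₂ (su , sv , u≢v)

          split : ∀ u v → 𝟙 (Side? u) * 𝟙 (Side? v) ≤ 𝟙 (Side? u) * 𝟙 (u ≟ v) + 𝟙 (B? u v)
          split u v = begin
            𝟙 (Side? u) * 𝟙 (Side? v)                     ≡⟨ sym (𝟙-× (Side? u) (Side? v)) ⟩
            𝟙 (Side? u ×-dec Side? v)                     ≤⟨ 𝟙-union (Side? u ×-dec (u ≟ v)) (B? u v) (Side? u ×-dec Side? v) (cases u v) ⟩
            𝟙 (Side? u ×-dec (u ≟ v)) + 𝟙 (B? u v)        ≡⟨ cong (_+ 𝟙 (B? u v)) (𝟙-× (Side? u) (u ≟ v)) ⟩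
            𝟙 (Side? u) * 𝟙 (u ≟ v) + 𝟙 (B? u v)          ∎

        both : N * (N ∸ 1) ≤ bothPairs
        both = ≤-trans (≤-reflexive (trans (*-distribˡ-∸ N N 1) (cong (N * N ∸_) (*-identityʳ N))))
          (≤-trans (∸-monoˡ-≤ N square) (≤-reflexive (m+n∸m≡n N bothPairs)))

      large-side : End (p h) x → 1 + j ≤ count Side?
      large-side x∈ = ≤-trans (inner h (p h)) (sum-mono-≤ λ v →
        𝟙-mono (Inner? h (p h) v) (Side? v) λ (hv , v∉) → hv , inj₁ (x∈ , v∉))

      small-side : ¬ End (p h) x → 2 ≤ count Side?
      small-side x∉ = pair-size Side? (p h) proper λ v∈ → end-mem {h} v∈ , inj₂ (x∉ , v∈)

    -- The slack is exactly 2(k - 3)(ω - 1), so there is none for k = 3.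
    gain-large : ∀ {ω P C P′ C′} → 1 ≤ ω → P + 2 * ((1 + j) * ω) + (1 + j) * j ≤ P′ → C′ ≤ C + k * (2 + j) →
                 P + C′ + 2 * ω ≤ P′ + C + 2 * k
    gain-large {suc w} {P} {C} {P′} {C′} _ P≤ C≤ = begin
      P + C′ + 2 * suc w                                                      ≤⟨ +-monoˡ-≤ (2 * suc w) (+-monoʳ-≤ P C≤) ⟩
      P + (C + k * (2 + j)) + 2 * suc w                                       ≤⟨ m≤m+n _ (2 * (j * w)) ⟩
      P + (C + k * (2 + j)) + 2 * suc w + 2 * (j * w)                         ≡⟨ identity j w P C ⟩
      P + 2 * ((1 + j) * suc w) + (1 + j) * j + C + 2 * k                     ≤⟨ +-monoˡ-≤ (2 * k) (+-monoˡ-≤ C P≤) ⟩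
      P′ + C + 2 * k                                                          ∎
      where
      open ≤-Reasoning
      identity : ∀ j w P C → P + (C + (3 + j) * (2 + j)) + 2 * suc w + 2 * (j * w) ≡
                 P + 2 * ((1 + j) * suc w) + (1 + j) * j + C + 2 * (3 + j)
      identity = solve-∀

    -- The released surplus leaves a net price of k(k - 1) - k(k - 3) = 2k, which the pairs of two
    -- new vertices can pay.
    gain-closing : ∀ {ω P C P′ C′} → P + 2 * (2 * ω) + 2 ≤ P′ → C′ + k * j ≤ C + k * (2 + j) →
                   P + C′ + 2 * ω ≤ P′ + C + 2 * k
    gain-closing {ω} {P} {C} {P′} {C′} P≤ C≤ = +-cancelʳ-≤ (k * j) _ _ (begin
      P + C′ + 2 * ω + k * j                                     ≡⟨ left j ω P C′ ⟩
      P + 2 * ω + (C′ + k * j)                                   ≤⟨ +-monoʳ-≤ (P + 2 * ω) C≤ ⟩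
      P + 2 * ω + (C + k * (2 + j))                              ≤⟨ m≤m+n _ (2 * ω + 2) ⟩
      P + 2 * ω + (C + k * (2 + j)) + (2 * ω + 2)                ≡⟨ right j ω P C ⟩
      P + 2 * (2 * ω) + 2 + C + 2 * k + k * j                    ≤⟨ +-monoˡ-≤ (k * j) (+-monoˡ-≤ (2 * k) (+-monoˡ-≤ C P≤)) ⟩
      P′ + C + 2 * k + k * j                                     ∎)
      where
      open ≤-Reasoning
      left : ∀ j ω P C′ → P + C′ + 2 * ω + (3 + j) * j ≡ P + 2 * ω + (C′ + (3 + j) * j)
      left = solve-∀
      right : ∀ j ω P C → P + 2 * ω + (C + (3 + j) * (2 + j)) + (2 * ω + 2) ≡
              P + 2 * (2 * ω) + 2 + C + 2 * (3 + j) + (3 + j) * j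
      right = solve-∀

    -- The first edge brings two vertices and may run a deficit. The second brings k - 2 vertices,
    -- each paired with at least ω + 2 others, and ω ≥ k makes this enough for both edges.
    gain-small-large : ∀ {ω P C P₁ C₁ P₂ C₂} → k ≤ ω → P + 2 * (2 * ω) + 2 ≤ P₁ → C₁ ≤ C + k * (2 + j) →
                       P₁ + 2 * ((1 + j) * (ω + 2)) + (1 + j) * j ≤ P₂ → C₂ ≤ C₁ + k * (2 + j) →
                       P + C₂ + 2 * ω ≤ P₂ + C + 2 * k
    gain-small-large {ω} {P} {C} {P₁} {C₁} {P₂} {C₂} k≤ω P₁≤ C₁≤ P₂≤ C₂≤ with m≤n⇒∃[o]m+o≡n k≤ω
    ... | w , refl = begin
      P + C₂ + 2 * (k + w)                                              ≤⟨ +-monoˡ-≤ (2 * (k + w)) (+-monoʳ-≤ P (≤-trans C₂≤ (+-monoˡ-≤ (k * (2 + j)) C₁≤))) ⟩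
      P + (C + k * (2 + j) + k * (2 + j)) + 2 * (k + w)                 ≤⟨ m≤m+n _ (12 + 7 * j + 4 * w + j * j + 2 * (j * w)) ⟩
      P + (C + k * (2 + j) + k * (2 + j)) + 2 * (k + w) + (12 + 7 * j + 4 * w + j * j + 2 * (j * w))
                                                                        ≡⟨ identity j w P C ⟩
      P + 2 * (2 * (k + w)) + 2 + 2 * ((1 + j) * (k + w + 2)) + (1 + j) * j + C + 2 * k
                                                                        ≤⟨ +-monoˡ-≤ (2 * k) (+-monoˡ-≤ C (≤-trans (+-monoˡ-≤ ((1 + j) * j) (+-monoˡ-≤ _ P₁≤)) P₂≤)) ⟩
      P₂ + C + 2 * k                                                    ∎
      where
      open ≤-Reasoning
      identity : ∀ j w P C → P + (C + (3 + j) * (2 + j) + (3 + j) * (2 + j)) + 2 * (3 + j + w) + (12 + 7 * j + 4 * w + j * j + 2 * (j * w)) ≡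
                 P + 2 * (2 * (3 + j + w)) + 2 + 2 * ((1 + j) * (3 + j + w + 2)) + (1 + j) * j + C + 2 * (3 + j)
      identity = solve-∀

    -- The k - 2 vertices of the second edge now join one class and are paired only with the
    -- vertices outside it, at least 1 + ω. In return the petal costs 2(k - 1) + k(k - 3) even with
    -- its surplus.
    gain-small-petal : ∀ {ω P C P₁ C₁ P₂ C₂} → k ≤ ω → P + 2 * (2 * ω) + 2 ≤ P₁ → C₁ ≤ C + k * (2 + j) →
                       P₁ + 2 * ((1 + j) * (1 + ω)) ≤ P₂ → C₂ ≤ C₁ + (2 * (2 + j) + k * j) →
                       P + C₂ + 2 * ω ≤ P₂ + C + 2 * k
    gain-small-petal {ω} {P} {C} {P₁} {C₁} {P₂} {C₂} k≤ω P₁≤ C₁≤ P₂≤ C₂≤ with m≤n⇒∃[o]m+o≡n k≤ω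
    ... | w , refl = begin
      P + C₂ + 2 * (k + w)                                              ≤⟨ +-monoˡ-≤ (2 * (k + w)) (+-monoʳ-≤ P (≤-trans C₂≤ (+-monoˡ-≤ _ C₁≤))) ⟩
      P + (C + k * (2 + j) + (2 * (2 + j) + k * j)) + 2 * (k + w)       ≤⟨ m≤m+n _ (12 + 4 * j + 4 * w + 2 * (j * w)) ⟩
      P + (C + k * (2 + j) + (2 * (2 + j) + k * j)) + 2 * (k + w) + (12 + 4 * j + 4 * w + 2 * (j * w))
                                                                        ≡⟨ identity j w P C ⟩
      P + 2 * (2 * (k + w)) + 2 + 2 * ((1 + j) * (1 + (k + w))) + C + 2 * k
                                                                        ≤⟨ +-monoˡ-≤ (2 * k) (+-monoˡ-≤ C (≤-trans (+-monoˡ-≤ _ P₁≤) P₂≤)) ⟩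
      P₂ + C + 2 * k                                                    ∎
      where
      open ≤-Reasoning
      identity : ∀ j w P C → P + (C + (3 + j) * (2 + j) + (2 * (2 + j) + (3 + j) * j)) + 2 * (3 + j + w) + (12 + 4 * j + 4 * w + 2 * (j * w)) ≡
                 P + 2 * (2 * (3 + j + w)) + 2 + 2 * ((1 + j) * (1 + (3 + j + w))) + C + 2 * (3 + j)
      identity = solve-∀

    -- If p h = (a , b) contains neither x nor y, only a and b join, too few to pay
    -- for h when k is large. But a has even degree, so a second edge f has a as an
    -- end: f is a petal closing at a, or it can be explored next.
    grow : (S : Structure) → k ≤ span S → ∀ {h x y} → kind S h ≡ fresh → Mem h x → Mem h y →
           Structure.Cross S x y → Σ Structure λ S′ → Grown S S′ h
    grow S k≤ω {h} {x} {y} h-new hx hy cross with End? (p h) x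
    ... | yes x∈ = extend , record
      { gain         = gain-large {span S} {pairs S} (≤-trans (s≤s z≤n) k≤ω) (side-pairs (large-side x∈) ≤-refl) cost-bound
      ; bigger       = ≤-trans (≤-reflexive (+-comm 1 (span S)))
                         (≤-trans (+-monoʳ-≤ (span S) (≤-trans (s≤s z≤n) (large-side x∈))) order-bound)
      ; keepCross    = Cross-mono
      ; keepExplored = explored-mono _ ∘ inj₁
      ; explored-hub = explored-mono h (inj₂ refl)
      }
      where open AddSide S h-new hx hy cross
    ... | no x∉ = follow (other-edge p h even A.proper a∈h)
      where
      module S = Structure S
      module A = AddSide S h-new hx hy cross
      S₁ = A.extend
      module S₁ = Structure S₁

      a = proj₁ (p h)

      a∈h : End (p h) a
      a∈h = inj₁ refl

      a-side : A.Side a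
      a-side = end-mem {h} a∈h , inj₂ (x∉ , a∈h)

      a-out : ¬ S.In a
      a-out = A.side-new a-side

      root-a : S₁.root a ≡ a
      root-a = A.newRoot-new a-side

      -- `a` names its own class, and no old vertex can have it as root because old roots are old
      -- vertices.
      alone : ∀ {v} → S₁.In v → S₁.root v ≡ S₁.root a → v ≡ a
      alone (inj₁ iv) eq = contradiction (subst S.In (trans (sym (A.newRoot-old iv)) (trans eq root-a)) (S.root-in iv)) a-out
      alone (inj₂ sv) eq = trans (sym (A.newRoot-new sv)) (trans eq root-a)

      two = A.small-side x∉

      ω+2≤ : span S + 2 ≤ span S₁
      ω+2≤ = ≤-trans (+-monoʳ-≤ (span S) two) A.order-bound

      bigger₁ : span S < span S₁
      bigger₁ = ≤-trans (≤-trans (≤-reflexive (+-comm 1 (span S))) (+-monoʳ-≤ (span S) (s≤s z≤n))) ω+2≤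

      follow : (∃ λ f → f ≢ h × Proper (p f) × End (p f) a) → Σ Structure λ S′ → Grown S S′ h
      follow (f , f≢h , pf , a∈f) with S.kind f in eq
      ... | full = contradiction (S.full-ends f eq pf a a∈f) a-out
      ... | petal q = S₁ , record
        { gain         = gain-closing {span S} {pairs S} (A.side-pairs two ≤-refl) (A.cost-bound-closing f q eq (subst A.Side a≡q a-side))
        ; bigger       = bigger₁
        ; keepCross    = A.Cross-mono
        ; keepExplored = A.explored-mono _ ∘ inj₁
        ; explored-hub = A.explored-mono h (inj₂ refl)
        }
        where
        -- The rim of a petal consists of old vertices, so the new vertex `a` can only be its tip.
        a≡q : a ≡ q
        a≡q with a ≟ q
        ... | yes a≡q = a≡q
        ... | no a≢q  = contradiction (proj₁ (proj₂ (S.petal-rim f q eq) a (end-mem {f} a∈f) a≢q)) a-out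
      ... | fresh = finish (S₁.In? q)
        where
        q = proj₁ (other-end f pf a∈f)
        q∈f = proj₁ (proj₂ (other-end f pf a∈f))
        a≢q = proj₁ (proj₂ (proj₂ (other-end f pf a∈f)))
        a-or-q = proj₂ (proj₂ (proj₂ (other-end f pf a∈f)))

        f-new : S₁.kind f ≡ fresh
        f-new = trans (A.newKind-there f≢h) eq

        f∉ : ¬ S₁.explored f
        f∉ e = subst Explored f-new e

        fa = end-mem {f} a∈f

        finish : Dec (S₁.In q) → Σ Structure λ S′ → Grown S S′ h
        -- The pair chosen in `f` is formed by `a` and `q`, now in different classes, so the whole
        -- rest of `f` is new.
        finish (yes iq) = B.extend , record
          { gain         = gain-small-large {span S} {pairs S} k≤ω (A.side-pairs two ≤-refl) A.cost-bound
                             (B.side-pairs (B.large-side a∈f) ω+2≤) B.cost-bound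
          ; bigger       = ≤-trans bigger₁ (≤-trans (m≤m+n _ _) B.order-bound)
          ; keepCross    = B.Cross-mono ∘ A.Cross-mono
          ; keepExplored = B.explored-mono _ ∘ inj₁ ∘ A.explored-mono _ ∘ inj₁
          ; explored-hub = B.explored-mono h (inj₁ (A.explored-mono h (inj₂ refl)))
          }
          where module B = AddSide S₁ f-new fa (end-mem {f} q∈f) (inj₂ a-side , iq , λ eq → a≢q (sym (alone iq (sym eq))))
        -- With `q` still outside, only `a` can be traded: the other non-ends of `f` join its class,
        -- and `f` becomes a petal with tip `q`.
        finish (no ¬iq) = B.extend , record
          { gain         = gain-small-petal {span S} {pairs S} k≤ω (A.side-pairs two ≤-refl) A.cost-bound
                             (≤-trans (+-monoʳ-≤ (pairs S₁) (*-monoʳ-≤ 2 (*-mono-≤ (inner f (p f)) outside-class))) B.attach-pairs)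
                             (≤-trans B.cost-bound (+-monoʳ-≤ (cost S₁) petal-cost))
          ; bigger       = ≤-trans bigger₁ (≤-trans (m≤m+n _ _) B.order-bound)
          ; keepCross    = B.Cross-mono ∘ A.Cross-mono
          ; keepExplored = B.explored-mono _ ∘ inj₁ ∘ A.explored-mono _ ∘ inj₁
          ; explored-hub = B.explored-mono h (inj₁ (A.explored-mono h (inj₂ refl)))
          }
          where
          reach : ∀ {o l} → Mem f o × ¬ End (p f) o → S₁.In l → S₁.root l ≢ S₁.root a → Reroute (S₁.explored +ₑ f) o l
          reach (fo , o∉) il l≁a = toggle (S₁.reroute (inj₂ a-side) il (l≁a ∘ sym)) f∉ pf fa fo (inj₁ (a∈f , o∉))

          new : ∀ {o} → Mem f o × ¬ End (p f) o → ¬ S₁.In o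
          new {o} fo io with S₁.root o ≟ S₁.root a
          ... | yes o∼a = proj₂ fo (subst (End (p f)) (sym (alone io o∼a)) a∈f)
          ... | no o≁a  = Reroute-irrefl (reach fo io o≁a)

          tip : ∀ q′ → petal q ≡ petal q′ → Mem f q′
          tip _ refl = end-mem {f} q∈f

          rim : ∀ q′ → petal q ≡ petal q′ → ∀ v → Mem f v → v ≢ q′ →
                (S₁.In v × S₁.root v ≡ S₁.root a) ⊎ (Mem f v × ¬ End (p f) v)
          rim _ refl v fv v≢q with End? (p f) v
          ... | no v∉  = inj₂ (fv , v∉)
          ... | yes v∈ with a-or-q v∈
          ...   | inj₁ refl = inj₁ (inj₂ a-side , refl)
          ...   | inj₂ v≡q  = contradiction v≡q v≢q

          module B = Attach S₁ f f-new a (inj₂ a-side) (λ v → Mem f v × ¬ End (p f) v) (Inner? f (p f)) new (petal q) tt reach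
            (λ ()) tip rim

          petal-cost : 2 * (2 + j) + 𝟙 (¬? (Structure.In? B.extend q)) * (k * j) ≤ 2 * (2 + j) + k * j
          petal-cost = +-monoʳ-≤ (2 * (2 + j)) (≤-trans (*-monoˡ-≤ (k * j) (𝟙≤1 (¬? (Structure.In? B.extend q)))) (≤-reflexive (*-identityˡ (k * j))))

          -- The class of `a` is `a` alone, so only one of at least ω + 2 vertices is lost.
          outside-class : 1 + span S ≤ count B.Outside?
          outside-class = +-cancelʳ-≤ 1 _ _ (begin
            1 + span S + 1                     ≡⟨ trans (+-comm (1 + span S) 1) (+-comm 2 (span S)) ⟩
            span S + 2                         ≤⟨ ω+2≤ ⟩
            span S₁                            ≤⟨ sum-mono-≤ (λ l → 𝟙-union (B.Outside? l) (a ≟ l) (S₁.In? l) (split l)) ⟩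
            sum (λ l → 𝟙 (B.Outside? l) + 𝟙 (a ≟ l)) ≡⟨ ∑-distrib-+ (𝟙 ∘ B.Outside?) (𝟙 ∘ (a ≟_)) ⟩
            count B.Outside? + count (a ≟_)      ≡⟨ cong (count B.Outside? +_) (count-≟ a) ⟩
            count B.Outside? + 1                 ∎)
            where
            open ≤-Reasoning
            split : ∀ l → S₁.In l → (S₁.In l × S₁.root l ≢ S₁.root a) ⊎ a ≡ l
            split l il with S₁.root l ≟ S₁.root a
            ... | yes l∼a = inj₂ (sym (alone il l∼a))
            ... | no l≁a  = inj₁ (il , l≁a)

    -- By `gain` the hypothesis turns into `cost S′ < pairs S′`. This gives the next open edge and,
    -- as `span S′` is at least k, the hypothesis again. Every step adds a vertex, so the fuel
    -- bounds the number of steps. Openness is assumed separately, because the inequality alone does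
    -- not imply it at the start.
    exhaust : ∀ fuel (S : Structure) → n ≤ span S + fuel → k ≤ span S →
              cost S + 2 * k < pairs S + 2 * span S → ¬ Coverage.Open S
    exhaust fuel S n≤ k≤ω lt (h , x , y , h-new , hx , hy , c) with grow S k≤ω h-new hx hy c
    ... | S′ , G = continue fuel n≤
      where
      open Grown G

      lt′ : cost S′ < pairs S′
      lt′ = +-cancelˡ-< (pairs S + 2 * span S) _ _ (begin-strict
        pairs S + 2 * span S + cost S′   ≡⟨ trans (+-assoc (pairs S) _ _) (trans (cong (pairs S +_) (+-comm (2 * span S) _)) (sym (+-assoc (pairs S) _ _))) ⟩
        pairs S + cost S′ + 2 * span S   ≤⟨ gain ⟩
        pairs S′ + cost S + 2 * k          ≡⟨ trans (+-assoc (pairs S′) _ _) (+-comm (pairs S′) _) ⟩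
        cost S + 2 * k + pairs S′          <⟨ +-monoˡ-< (pairs S′) lt ⟩
        pairs S + 2 * span S + pairs S′  ∎)
        where open ≤-Reasoning

      k≤ω′ : k ≤ span S′
      k≤ω′ = ≤-trans k≤ω (<⇒≤ bigger)

      continue : ∀ fuel → n ≤ span S + fuel → ⊥
      continue zero n≤ = <⇒≱ bigger (≤-trans (count≤n (Structure.In? S′)) (≤-trans n≤ (≤-reflexive (+-identityʳ _))))
      continue (suc fuel) n≤ = exhaust fuel S′
        (≤-trans n≤ (≤-trans (≤-reflexive (+-suc (span S) fuel)) (+-monoˡ-≤ fuel bigger)))
        k≤ω′ (+-mono-<-≤ lt′ (*-monoʳ-≤ 2 k≤ω′)) (Coverage.open-< S′ lt′)

    module Unused (e : Edge) (improper : ¬ Proper (p e)) where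

      initial-kind : Edge → Kind
      initial-kind f = if does (f ≟ e) then full else fresh

      initial-kind-e : initial-kind e ≡ full
      initial-kind-e with e ≟ e
      ... | yes _ = refl
      ... | no ¬p = contradiction refl ¬p

      initial-kind-fresh : ∀ {f} → f ≢ e → initial-kind f ≡ fresh
      initial-kind-fresh {f} f≢e with f ≟ e
      ... | yes f≡e = contradiction f≡e f≢e
      ... | no _    = refl

      -- Any two vertices of `e` can become its pair, so all of them form singleton classes. There
      -- are k(k - 1) pairs, the cost is the same and the span is k: the inequality of `exhaust`
      -- misses strictness by nothing but equality.
      initial : Structure
      initial .Structure.In        = Mem e
      initial .Structure.In?       = Mem? e
      initial .Structure.root v    = v
      initial .Structure.root-in   = id
      initial .Structure.kind      = initial-kind
      initial .Structure.reroute {x} {y} ex ey x≢y = record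
        { choice      = set p e (x , y)
        ; admissible′ = admissible-set admissible ex ey
        ; agrees      = λ f f∉ → set-there p e (x , y) λ { refl → f∉ (subst Explored (sym initial-kind-e) tt) }
        ; parity′     = λ v → trans (parity-set p e (x , y) v) (cong₂ (λ s t → s xor (t xor (δ x v xor δ y v))) (even v) (ends-improper (p e) improper v))
        ; larger      = used-set-< p e improper x≢y
        }
      initial .Structure.full-ends f eq pf with f ≟ e
      initial .Structure.full-ends f eq pf | yes refl = contradiction pf improper
      initial .Structure.full-ends f () pf | no _
      initial .Structure.petal-tip f q eq with f ≟ e
      initial .Structure.petal-tip f q () | yes _
      initial .Structure.petal-tip f q () | no _
      initial .Structure.petal-rim f q eq with f ≟ e
      initial .Structure.petal-rim f q () | yes _
      initial .Structure.petal-rim f q () | no _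

      initial-pairs : k * (2 + j) ≤ pairs initial
      initial-pairs = ≤-trans (≤-reflexive (sym (pairsIn e))) (sum-mono-≤ λ x → sum-mono-≤ λ y →
        𝟙-mono (Mem? e x ×-dec (Mem? e y ×-dec ¬? (y ≟ x))) (Structure.Cross? initial x y) λ (ex , ey , y≢x) → ex , ey , y≢x ∘ sym)

      initial-cost : cost initial ≤ k * (2 + j)
      initial-cost = begin
        cost initial                                ≤⟨ sum-mono-≤ at ⟩
        sum (λ f → 𝟙 (e ≟ f) * (k * (2 + j)))     ≡⟨ sym (*-distribʳ-sum (k * (2 + j)) (𝟙 ∘ (e ≟_))) ⟩
        count (e ≟_) * (k * (2 + j))              ≡⟨ trans (cong (_* (k * (2 + j))) (count-≟ e)) (*-identityˡ _) ⟩
        k * (2 + j)                               ∎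
        where
        open ≤-Reasoning
        at : ∀ f → Structure.kindCost initial (initial-kind f) ≤ 𝟙 (e ≟ f) * (k * (2 + j))
        at f with f ≟ e
        ... | yes refl = ≤-reflexive (sym (trans (cong (_* (k * (2 + j))) (𝟙-yes (e ≟ e) refl)) (*-identityˡ _)))
        ... | no _     = z≤n

      initial-order : span initial ≡ k
      initial-order = card e

      -- After growing from an edge h that shares x and y with e, the pair x, y is
      -- contained in two explored edges, which makes up for the lack of a strict bound.
      meets-once : ∀ {h x y} → h ≢ e → Mem h x → Mem e x → Mem h y → Mem e y → x ≡ y
      meets-once {h} {x} {y} h≢e hx ex hy ey with x ≟ y
      ... | yes x≡y = x≡y
      ... | no x≢y with grow initial (≤-reflexive (sym initial-order)) (initial-kind-fresh h≢e) hx hy (ex , ey , x≢y)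
      ...   | S₁ , G = ⊥-elim (exhaust n S₁ (m≤n+m n _) (≤-trans (≤-reflexive (sym initial-order)) (<⇒≤ bigger))
                (+-mono-≤-< le (*-monoʳ-< 2 (≤-trans (s≤s (≤-reflexive (sym initial-order))) bigger)))
                (Coverage.open-≤ S₁ le (h≢e ∘ sym)
                  (keepExplored (subst Explored (sym initial-kind-e) tt) , ex , ey , keepCross (ex , ey , x≢y))
                  (explored-hub , hx , hy , keepCross (ex , ey , x≢y))))
        where
        open Grown G

        le : cost S₁ ≤ pairs S₁
        le = +-cancelˡ-≤ (k * (2 + j)) _ _ (+-cancelʳ-≤ (2 * k) _ _ (begin
          k * (2 + j) + cost S₁ + 2 * k            ≤⟨ +-mono-≤ (+-monoˡ-≤ (cost S₁) initial-pairs) (*-monoʳ-≤ 2 (≤-reflexive (sym initial-order))) ⟩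
          pairs initial + cost S₁ + 2 * span initial ≤⟨ gain ⟩
          pairs S₁ + cost initial + 2 * k            ≤⟨ +-monoˡ-≤ (2 * k) (≤-trans (+-monoʳ-≤ (pairs S₁) initial-cost) (≤-reflexive (+-comm (pairs S₁) _))) ⟩
          k * (2 + j) + pairs S₁ + 2 * k           ∎))
          where open ≤-Reasoning

      private module I = Structure initial

      unexplored : ∀ {f} → f ≢ e → ¬ I.explored f
      unexplored f≢e ex = subst Explored (initial-kind-fresh f≢e) ex

      outside-initial : ∀ {x} → Mem e x → 2 + j ≤ count (λ l → Mem? e l ×-dec ¬? (l ≟ x))
      outside-initial ex = ≤-reflexive (sym (rest e ex))

      another : ∀ {x} → Mem e x → ∃ λ v → Mem e v × v ≢ x
      another {x} ex = count-pos (λ l → Mem? e l ×-dec ¬? (l ≟ x)) (≤-trans (s≤s z≤n) (outside-initial ex))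

      -- The k - 2 vertices of `h` other than `x` and `q` are new by `meets-once`. They join the
      -- class of `x`, with `h` as a petal, and the balance rises from 0 to at least (k - 1)(k - 2).
      -- The hypothesis `reach` abstracts from how `h` trades `x` for them, which depends on whether
      -- `h` is used.
      petal-at : ∀ {h x q} → h ≢ e → Mem h x → Mem e x → Mem h q → x ≢ q →
                 (∀ {U o y} → Reroute U x y → ¬ U h → Mem h o × ¬ End (x , q) o → Reroute (U +ₑ h) o y) → ⊥
      petal-at {h} {x} {q} h≢e hx ex hq x≢q reach =
        exhaust n A.extend (m≤n+m n _) (≤-trans (m≤m+n k (1 + j)) order₁) bound
          -- For k = 3 the estimates give only `cost ≤ pairs`, so the next edge is exhibited: it
          -- joins a new vertex of `h` to a vertex of `e` other than `x`.
          (g , o , v , g-new , go , gv , inj₂ No , inj₁ ev , λ eq → v≢x (trans (sym (A.newRoot-old ev)) (trans (sym eq) (A.newRoot-new No))))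
        where
        N : Vertex → Set
        N o = Mem h o × ¬ End (x , q) o

        N-new : ∀ {o} → N o → ¬ Mem e o
        N-new (ho , o∉) eo = o∉ (inj₁ (meets-once h≢e ho eo hx ex))

        tip : ∀ q′ → petal q ≡ petal q′ → Mem h q′
        tip _ refl = hq

        rim : ∀ q′ → petal q ≡ petal q′ → ∀ v → Mem h v → v ≢ q′ → (Mem e v × v ≡ x) ⊎ N v
        rim _ refl v hv v≢q with v ≟ x
        ... | yes refl = inj₁ (ex , refl)
        ... | no v≢x   = inj₂ (hv , [ v≢x , v≢q ]′)

        module A = Attach initial h (initial-kind-fresh h≢e) x ex N (Inner? h (x , q)) N-new (petal q) tt
          (λ No il l≢x → reach (I.reroute ex il (l≢x ∘ sym)) (unexplored h≢e) No)
          (λ ()) tip rim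

        N-size = inner h (x , q)

        order₁ : k + (1 + j) ≤ span A.extend
        order₁ = ≤-trans (+-mono-≤ (≤-reflexive (sym initial-order)) N-size) A.order-bound

        pairs₁ : k * (2 + j) + 2 * ((1 + j) * (2 + j)) ≤ pairs A.extend
        pairs₁ = ≤-trans (+-mono-≤ initial-pairs (*-monoʳ-≤ 2 (*-mono-≤ N-size (outside-initial ex)))) A.attach-pairs

        cost₁ : cost A.extend ≤ k * (2 + j) + (2 * (2 + j) + 1 * (k * j))
        cost₁ = ≤-trans A.cost-bound (+-mono-≤ initial-cost (+-monoʳ-≤ (2 * (2 + j))
          (*-monoˡ-≤ (k * j) (𝟙≤1 (¬? (Structure.In? A.extend q))))))

        bound : cost A.extend + 2 * k < pairs A.extend + 2 * span A.extend
        bound = begin-strict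
          cost A.extend + 2 * k                                                   ≤⟨ +-monoˡ-≤ (2 * k) cost₁ ⟩
          k * (2 + j) + (2 * (2 + j) + 1 * (k * j)) + 2 * k                       <⟨ ≤-trans (m≤m+n _ (1 + 3 * j + j * j)) (≤-reflexive (identity j)) ⟩
          k * (2 + j) + 2 * ((1 + j) * (2 + j)) + 2 * (k + (1 + j))               ≤⟨ +-mono-≤ pairs₁ (*-monoʳ-≤ 2 order₁) ⟩
          pairs A.extend + 2 * span A.extend                                    ∎
          where
          open ≤-Reasoning
          identity : ∀ j → suc ((3 + j) * (2 + j) + (2 * (2 + j) + 1 * ((3 + j) * j)) + 2 * (3 + j)) + (1 + 3 * j + j * j) ≡
                     (3 + j) * (2 + j) + 2 * ((1 + j) * (2 + j)) + 2 * (3 + j + (1 + j))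
          identity = solve-∀

        No′ = count-pos (Inner? h (x , q)) (≤-trans (s≤s z≤n) N-size)
        o = proj₁ No′
        No = proj₂ No′

        v = proj₁ (another ex)
        ev = proj₁ (proj₂ (another ex))
        v≢x = proj₂ (proj₂ (another ex))

        gov = cover {o} {v} λ o≡v → N-new No (subst (Mem e) (sym o≡v) ev)
        g = proj₁ gov
        go = proj₁ (proj₂ gov)
        gv = proj₂ (proj₂ gov)

        g-new : kind A.extend g ≡ fresh
        g-new = trans (A.newKind-there λ g≡h → v≢x (meets-once h≢e (subst (λ f → Mem f v) g≡h gv) ev hx ex))
                      (initial-kind-fresh λ g≡e → N-new No (subst (λ f → Mem f o) g≡e go))

      -- If `x` is an end of `p h`, it can be exchanged for any non-end of `h`; the other end serves
      -- as the tip of the petal.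
      proper-end : ∀ {h x} → h ≢ e → Proper (p h) → End (p h) x → ¬ Mem e x
      proper-end {h} {x} h≢e ph x∈ ex =
        let q , q∈ , x≢q , only = other-end h ph x∈ in
        petal-at h≢e (end-mem {h} x∈) ex (end-mem {h} q∈) x≢q λ r h∉ (ho , o∉) →
          toggle r h∉ ph (end-mem {h} x∈) ho (inj₁ (x∈ , o∉ ∘ only))

      improper-meet : ∀ {h x q} → h ≢ e → Mem h x → Mem e x → Mem h q → x ≢ q → Proper (p h)
      improper-meet {h} h≢e hx ex hq x≢q with Proper? (p h)
      ... | yes ph = ph
      ... | no ¬ph = ⊥-elim (petal-at h≢e hx ex hq x≢q λ r h∉ (ho , o∉) →
        toggle-improper r h∉ ¬ph hx ho λ x≡o → o∉ (inj₁ (sym x≡o)))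

      -- If x were not in f, then a, b and the vertices of f could join the class of x,
      -- with f as a petal.
      both-sides : ∀ {h x f} → h ≢ e → Mem h x → Mem e x → Proper (p h) →
                   f ≢ h → Proper (p f) → End (p f) (proj₁ (p h)) → ¬ ¬ Mem f x
      both-sides {h} {x} {f} h≢e hx ex ph f≢h pf a∈f x∉f =
        exhaust n B.extend (m≤n+m n _) (≤-trans (m≤m+n k (2 + j)) order₂) bound
          (g , a , v , g-new , ga , gv , B.Cross-mono (a-in , inj₁ ev , λ eq → v≢x (trans (sym (A.newRoot-old ev)) (trans (sym eq) root-a))))
        where
        a = proj₁ (p h)

        f≢e : f ≢ e
        f≢e refl = improper pf

        fa = end-mem {f} a∈f

        x∉h : ¬ End (p h) x
        x∉h x∈ = proper-end h≢e ph x∈ ex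

        q = proj₁ (other-end f pf a∈f)
        q∈f = proj₁ (proj₂ (other-end f pf a∈f))
        a-or-q = proj₂ (proj₂ (proj₂ (other-end f pf a∈f)))

        module A = Attach initial h (initial-kind-fresh h≢e) x ex (End (p h)) (End? (p h))
          (λ o∈ → proper-end h≢e ph o∈) full tt
          (λ o∈ il l≢x → toggle (I.reroute ex il (l≢x ∘ sym)) (unexplored h≢e) ph hx (end-mem {h} o∈) (inj₂ (x∉h , o∈)))
          (λ _ _ v v∈ → inj₂ v∈) (λ _ ()) (λ _ ())

        S₁ = A.extend
        module S₁ = Structure S₁

        a-in : S₁.In a
        a-in = inj₂ (inj₁ refl)

        root-a : S₁.root a ≡ x
        root-a = A.newRoot-new (inj₁ refl)

        f-new : S₁.kind f ≡ fresh
        f-new = trans (A.newKind-there f≢h) (initial-kind-fresh f≢e)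

        reach : ∀ {o l} → Mem f o → ¬ End (p f) o → S₁.In l → S₁.root l ≢ S₁.root a → Reroute (S₁.explored +ₑ f) o l
        reach fo o∉ il l≁a = toggle (S₁.reroute a-in il (l≁a ∘ sym)) (λ ex → subst Explored f-new ex) pf fa fo (inj₁ (a∈f , o∉))

        same-class : ∀ {o} → Mem f o → ¬ End (p f) o → S₁.In o → S₁.root o ≡ S₁.root a
        same-class {o} fo o∉ io with S₁.root o ≟ S₁.root a
        ... | yes o∼a = o∼a
        ... | no o≁a  = ⊥-elim (Reroute-irrefl (reach fo o∉ io o≁a))

        -- A common vertex of `e` and `f` is no end of `p f`, so it has to be in the class of `a`,
        -- which contains no vertex of `e` but `x`.
        avoids : ∀ {v} → Mem e v → ¬ Mem f v
        avoids {v} ev fv with End? (p f) v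
        ... | yes v∈ = proper-end f≢e pf v∈ ev
        ... | no v∉  = x∉f (subst (Mem f) (trans (sym (A.newRoot-old ev)) (trans (same-class fv v∉ (inj₁ ev)) root-a)) fv)

        N : Vertex → Set
        N v = (Mem f v × ¬ End (p f) v) × ¬ S₁.In v

        N? : Decidable N
        N? v = Inner? f (p f) v ×-dec ¬? (S₁.In? v)

        tip : ∀ q′ → petal q ≡ petal q′ → Mem f q′
        tip _ refl = end-mem {f} q∈f

        rim : ∀ q′ → petal q ≡ petal q′ → ∀ v → Mem f v → v ≢ q′ → (S₁.In v × S₁.root v ≡ S₁.root a) ⊎ N v
        rim _ refl v fv v≢q with End? (p f) v | S₁.In? v
        ... | no v∉  | yes iv = inj₁ (iv , same-class fv v∉ iv)
        ... | no v∉  | no ¬iv = inj₂ ((fv , v∉) , ¬iv)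
        ... | yes v∈ | _ with a-or-q v∈
        ...   | inj₁ refl = inj₁ (a-in , refl)
        ...   | inj₂ v≡q  = contradiction v≡q v≢q

        module B = Attach S₁ f f-new a a-in N N? proj₂ (petal q) tt
          (λ ((fo , o∉) , _) → reach fo o∉) (λ ()) tip rim

        two : 2 ≤ count (End? (p h))
        two = pair-size (End? (p h)) (p h) ph id

        -- Of the k - 2 non-ends of `f` at most one is already present, namely the second end `b` of
        -- `p h`.
        N-size : j ≤ count N?
        N-size = +-cancelʳ-≤ 1 _ _ (begin
          j + 1                                    ≡⟨ +-comm j 1 ⟩
          1 + j                                    ≤⟨ inner f (p f) ⟩
          count (Inner? f (p f))                   ≤⟨ sum-mono-≤ (λ v → 𝟙-union (N? v) (b ≟ v) (Inner? f (p f) v) (cases v)) ⟩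
          sum (λ v → 𝟙 (N? v) + 𝟙 (b ≟ v))         ≡⟨ ∑-distrib-+ (𝟙 ∘ N?) (𝟙 ∘ (b ≟_)) ⟩
          count N? + count (b ≟_)                  ≡⟨ cong (count N? +_) (count-≟ b) ⟩
          count N? + 1                             ∎)
          where
          open ≤-Reasoning
          b = proj₂ (p h)

          cases : ∀ v → Mem f v × ¬ End (p f) v → N v ⊎ b ≡ v
          cases v (fv , v∉) with S₁.In? v
          ... | no ¬iv                   = inj₁ ((fv , v∉) , ¬iv)
          ... | yes (inj₁ ev)            = contradiction fv (avoids ev)
          ... | yes (inj₂ (inj₁ refl))   = contradiction a∈f v∉
          ... | yes (inj₂ (inj₂ v≡b))    = inj₂ (sym v≡b)

        outside₁ : 2 + j ≤ count B.Outside?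
        outside₁ = ≤-trans (outside-initial ex) (sum-mono-≤ λ l → 𝟙-mono (Mem? e l ×-dec ¬? (l ≟ x)) (B.Outside? l)
          λ (el , l≢x) → inj₁ el , λ eq → l≢x (trans (sym (A.newRoot-old el)) (trans eq root-a)))

        order₂ : k + (2 + j) ≤ span B.extend
        order₂ = ≤-trans (≤-reflexive (sym (+-assoc k 2 j)))
          (≤-trans (+-mono-≤ (≤-trans (+-mono-≤ (≤-reflexive (sym initial-order)) two) A.order-bound) N-size) B.order-bound)

        pairs₂ : k * (2 + j) + 2 * (2 * (2 + j)) + 2 * (j * (2 + j)) ≤ pairs B.extend
        pairs₂ = ≤-trans (+-mono-≤
          (≤-trans (+-mono-≤ initial-pairs (*-monoʳ-≤ 2 (*-mono-≤ two (outside-initial ex)))) A.attach-pairs)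
          (*-monoʳ-≤ 2 (*-mono-≤ N-size outside₁))) B.attach-pairs

        cost₂ : cost B.extend ≤ k * (2 + j) + k * (2 + j) + (2 * (2 + j) + 1 * (k * j))
        cost₂ = ≤-trans B.cost-bound (+-mono-≤ (≤-trans A.cost-bound (+-monoˡ-≤ (k * (2 + j)) initial-cost))
          (+-monoʳ-≤ (2 * (2 + j)) (*-monoˡ-≤ (k * j) (𝟙≤1 (¬? (Structure.In? B.extend q))))))

        bound : cost B.extend + 2 * k < pairs B.extend + 2 * span B.extend
        -- The estimates leave a margin of exactly 2 for every k. Without the span terms they would
        -- not suffice, which is why the open edge `g` is exhibited.
        bound = begin-strict
          cost B.extend + 2 * k                                                               ≤⟨ +-monoˡ-≤ (2 * k) cost₂ ⟩
          k * (2 + j) + k * (2 + j) + (2 * (2 + j) + 1 * (k * j)) + 2 * k                     <⟨ ≤-trans (m≤m+n _ 1) (≤-reflexive (identity j)) ⟩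
          k * (2 + j) + 2 * (2 * (2 + j)) + 2 * (j * (2 + j)) + 2 * (k + (2 + j))             ≤⟨ +-mono-≤ pairs₂ (*-monoʳ-≤ 2 order₂) ⟩
          pairs B.extend + 2 * span B.extend                                                ∎
          where
          open ≤-Reasoning
          identity : ∀ j → suc ((3 + j) * (2 + j) + (3 + j) * (2 + j) + (2 * (2 + j) + 1 * ((3 + j) * j)) + 2 * (3 + j)) + 1 ≡
                     (3 + j) * (2 + j) + 2 * (2 * (2 + j)) + 2 * (j * (2 + j)) + 2 * (3 + j + (2 + j))
          identity = solve-∀

        v = proj₁ (another ex)
        ev = proj₁ (proj₂ (another ex))
        v≢x = proj₂ (proj₂ (another ex))

        a∉e : ¬ Mem e a
        a∉e = proper-end h≢e ph (inj₁ refl)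

        gav = cover {a} {v} λ a≡v → a∉e (subst (Mem e) (sym a≡v) ev)
        g = proj₁ gav
        ga = proj₁ (proj₂ gav)
        gv = proj₂ (proj₂ gav)

        g-new : kind B.extend g ≡ fresh
        g-new = trans (B.newKind-there λ g≡f → avoids ev (subst (λ f → Mem f v) g≡f gv))
          (trans (A.newKind-there λ g≡h → v≢x (meets-once h≢e (subst (λ f → Mem f v) g≡h gv) ev hx ex))
                 (initial-kind-fresh λ g≡e → a∉e (subst (λ f → Mem f a) g≡e ga)))

    ends-other : ∀ f {c} (pf : Proper (p f)) (c∈ : End (p f) c) v →
                 ends (p f) v ≡ δ c v xor δ (proj₁ (other-end f pf c∈)) v
    ends-other f pf (inj₁ refl) v = refl
    ends-other f pf (inj₂ refl) v = xor-comm (δ (proj₁ (p f)) v) (δ (proj₂ (p f)) v)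

  -- The second edge `h₀` supplies a vertex `z` outside `e`, and thus an edge `h` that meets `e` in
  -- `x`. By `both-sides` a second edge `f` at the end `a` of `h` contains `x` as well; but then
  -- `Swap` gives a maximal choice that still leaves out `e` and has `x` as an end of `h`, against
  -- `proper-end`.
  all-proper : ∀ p → Admissible p → Even p → (∀ p′ → Admissible p′ → Even p′ → ¬ used p < used p′) →
               ∀ e {h₀} → h₀ ≢ e → ¬ ¬ Proper (p e)
  all-proper p adm even maximal e {h₀} h₀≢e improper =
    both-sides h≢e hx ex ph f≢h pf a∈f λ fx → Swap.proper-end fx h≢e (Swap.h-proper fx) (Swap.x∈h fx) ex
    where
    open Maximal p adm even maximal
    open Unused e improper

    x = proj₁ (p e)
    ex = proj₁ (adm e)

    -- Were `h₀` contained in `e`, they would share more than one vertex.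
    beyond : ∃ λ z → Mem h₀ z × ¬ Mem e z
    beyond with any? (λ z → Mem? h₀ z ×-dec ¬? (Mem? e z))
    ... | yes found = found
    ... | no none =
      let y = proj₁ (p h₀)
          hy = proj₁ (adm h₀)
          z , hz , z≢y = count-pos (λ z → Mem? h₀ z ×-dec ¬? (z ≟ y)) (≤-trans (s≤s z≤n) (≤-reflexive (sym (rest h₀ hy))))
      in contradiction (meets-once h₀≢e hz (in-e hz) hy (in-e hy)) z≢y
      where
      in-e : ∀ {z} → Mem h₀ z → Mem e z
      in-e {z} hz with Mem? e z
      ... | yes ez = ez
      ... | no ¬ez = contradiction (z , hz , ¬ez) none

    z = proj₁ beyond
    z∉e = proj₂ (proj₂ beyond)

    x≢z : x ≢ z
    x≢z x≡z = z∉e (subst (Mem e) x≡z ex)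

    h = proj₁ (cover x≢z)
    hx = proj₁ (proj₂ (cover x≢z))
    hz = proj₂ (proj₂ (cover x≢z))

    h≢e : h ≢ e
    h≢e h≡e = z∉e (subst (λ f → Mem f z) h≡e hz)

    ph = improper-meet h≢e hx ex hz x≢z

    a = proj₁ (p h)
    b = proj₂ (p h)

    next = other-edge p h even ph (inj₁ refl)
    f = proj₁ next
    f≢h = proj₁ (proj₂ next)
    pf = proj₁ (proj₂ (proj₂ next))
    a∈f = proj₂ (proj₂ (proj₂ next))

    f≢e : f ≢ e
    f≢e f≡e = improper (subst (Proper ∘ p) f≡e pf)

    -- Both h and f can trade their common anchor a for x, so x becomes an anchor of h.
    module Swap (fx : Mem f x) where
      q = proj₁ (other-end f pf a∈f)
      q∈f = proj₁ (proj₂ (other-end f pf a∈f))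

      x≢b : x ≢ b
      x≢b x≡b = proper-end h≢e ph (inj₂ x≡b) ex

      x≢q : x ≢ q
      x≢q x≡q = proper-end f≢e pf (subst (End (p f)) (sym x≡q) q∈f) ex

      p₁ p₂ : Choice
      p₁ = set p h (x , b)
      p₂ = set p₁ f (x , q)

      even₂ : Even p₂
      even₂ v = begin
        parity p₂ v
          ≡⟨ parity-set p₁ f (x , q) v ⟩
        parity p₁ v xor (ends (p₁ f) v xor (δ x v xor δ q v))
          ≡⟨ cong₂ (λ s t → s xor (t xor (δ x v xor δ q v))) (parity-set p h (x , b) v)
               (trans (cong (λ cd → ends cd v) (set-there p h (x , b) f≢h)) (ends-other f pf a∈f v)) ⟩
        (parity p v xor ((δ a v xor δ b v) xor (δ x v xor δ b v))) xor ((δ a v xor δ q v) xor (δ x v xor δ q v))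
          ≡⟨ solve 5 (λ s a b x q → (s :+ ((a :+ b) :+ (x :+ b))) :+ ((a :+ q) :+ (x :+ q)) := s) refl
               (parity p v) (δ a v) (δ b v) (δ x v) (δ q v) ⟩
        parity p v
          ≡⟨ even v ⟩
        false ∎
        where
        open ≡-Reasoning
        open xor-∧-Solver

      p₂-e : p₂ e ≡ p e
      p₂-e = trans (set-there p₁ f (x , q) (f≢e ∘ sym)) (set-there p h (x , b) (h≢e ∘ sym))

      p₂-h : p₂ h ≡ (x , b)
      p₂-h = trans (set-there p₁ f (x , q) (f≢h ∘ sym)) (set-here p h (x , b))

      h-proper : Proper (p₂ h)
      h-proper = subst Proper (sym p₂-h) x≢b

      x∈h : End (p₂ h) x
      x∈h = subst (λ cd → End cd x) (sym p₂-h) (inj₁ refl)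

      -- Both new pairs are proper, so `p₂` uses at least as many edges as `p` and inherits its
      -- maximality.
      open Maximal.Unused p₂ (admissible-set (admissible-set adm hx (proj₂ (adm h))) fx (end-mem {f} q∈f)) even₂
        (λ p′ adm′ even′ lt → maximal p′ adm′ even′
          (≤-trans (s≤s (≤-trans (used-set p h x≢b) (used-set p₁ f x≢q))) lt))
        e (subst (¬_ ∘ Proper) (sym p₂-e) improper) public using (proper-end)

  -- Existence of an even choice that uses every edge

  Perfect : Choice → Set
  Perfect p = Admissible p × Even p × (∀ f → Proper (p f))

  Perfect-resp : ∀ {p q} → (∀ f → p f ≡ q f) → Perfect p → Perfect q
  Perfect-resp p≗q (adm , even , proper) =
    (λ f → subst (λ ab → Mem f (proj₁ ab) × Mem f (proj₂ ab)) (p≗q f) (adm f)) ,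
    (λ v → trans (⨁-cong λ f → cong (λ ab → ends ab v) (sym (p≗q f))) (even v)) ,
    (λ f → subst Proper (p≗q f) (proper f))

  Perfect? : Decidable Perfect
  Perfect? p = all? (λ f → Mem? f (proj₁ (p f)) ×-dec Mem? f (proj₂ (p f))) ×-dec
               all? (λ v → parity p v Bool.≟ false) ×-dec all? (Proper? ∘ p)

  perfect-choice : 2 ≤ m → ∃ Perfect
  perfect-choice 2≤m with search-→ (search-× any? any?) Perfect-resp Perfect?
  ... | yes found = found
  ... | no none = ⊥-elim (climb m trivial (λ f → vertex-in f , vertex-in f) trivial-even (m≤n+m m _))
    where
    vertex : ∀ f → ∃ (Mem f)
    vertex f = count-pos (Mem? f) (≤-trans (s≤s z≤n) (≤-reflexive (sym (card f))))

    vertex-in = λ f → proj₂ (vertex f)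

    trivial : Choice
    trivial f = proj₁ (vertex f) , proj₁ (vertex f)

    trivial-even : Even trivial
    trivial-even v = trans (⨁-cong λ f → xor-same (δ (proj₁ (vertex f)) v)) (⨁-zeros m)

    different : ∀ {m} → 2 ≤ m → (e : Fin m) → ∃ λ h → h ≢ e
    different (s≤s (s≤s _)) zero    = suc zero , λ ()
    different (s≤s (s≤s _)) (suc e) = zero , λ ()

    -- No maximal choice is selected. The search has reduced the goal to a contradiction, so a
    -- better choice may be refuted by climbing on from it; this refutation is the maximality that
    -- `all-proper` needs. The fuel bounds the number of improvements, as at most `m` edges can be
    -- used.
    climb : ∀ fuel p → Admissible p → Even p → m ≤ used p + fuel → ⊥
    climb fuel p adm even m≤ = none (p , adm , even , λ f → decidable-stable (Proper? (p f))
      (all-proper p adm even (maximal fuel m≤) f (proj₂ (different 2≤m f))))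
      where
      maximal : ∀ fuel → m ≤ used p + fuel → ∀ p′ → Admissible p′ → Even p′ → ¬ used p < used p′
      maximal zero m≤ p′ _ _ lt = <⇒≱ lt (≤-trans (count≤n (Proper? ∘ p′)) (≤-trans m≤ (≤-reflexive (+-identityʳ _))))
      maximal (suc fuel) m≤ p′ adm′ even′ lt = climb fuel p′ adm′ even′
        (≤-trans m≤ (≤-trans (≤-reflexive (+-suc (used p) fuel)) (+-monoˡ-≤ fuel lt)))

-- Euler circuits

module _ {H : Hypergraph} where

  infixr 5 _⊕_
  _⊕_ : {u v w : V H} → Walk H u v → Walk H v w → Walk H u w
  stop _            ⊕ W′ = W′
  step u e ue ve u≢v W ⊕ W′ = step u e ue ve u≢v (W ⊕ W′)

  edges-⊕ : {u v w : V H} (W : Walk H u v) (W′ : Walk H v w) → edges (W ⊕ W′) ≡ edges W ++ edges W′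
  edges-⊕ (stop _)             W′ = refl
  edges-⊕ (step u e _ _ _ W) W′ = cong (e ∷_) (edges-⊕ W W′)

  anchors-⊕ : {u v w x : V H} (W : Walk H u v) (W′ : Walk H v w) →
              x List.∈ anchors (W ⊕ W′) → x List.∈ anchors W ⊎ x List.∈ anchors W′
  anchors-⊕ (stop _)           W′ x∈         = inj₂ x∈
  anchors-⊕ (step _ _ _ _ _ W) W′ (here x≡)  = inj₁ (here x≡)
  anchors-⊕ (step _ _ _ _ _ W) W′ (there x∈) with anchors-⊕ W W′ x∈
  ... | inj₁ x∈W  = inj₁ (there x∈W)
  ... | inj₂ x∈W′ = inj₂ x∈W′

  record Split {u w : V H} (W : Walk H u w) (v : V H) : Set where
    field
      before         : Walk H u v
      after          : Walk H v w
      edges-split    : edges before ++ edges after ≡ edges W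
      anchors-before : ∀ {x} → x List.∈ anchors before → x List.∈ anchors W
      anchors-after  : ∀ {x} → x List.∈ anchors after → x List.∈ anchors W

  split : {u w : V H} (W : Walk H u w) {v : V H} → v List.∈ anchors W → Split W v
  split (stop u) (here refl) = record
    { before = stop u ; after = stop u ; edges-split = refl ; anchors-before = id ; anchors-after = id }
  split (step u e ue ve u≢v W) (here refl) = record
    { before = stop u ; after = step u e ue ve u≢v W ; edges-split = refl
    ; anchors-before = λ { (here x≡u) → here x≡u } ; anchors-after = id }
  split (step u e ue ve u≢v W) (there v∈) = record
    { before = step u e ue ve u≢v before ; after = after ; edges-split = cong (e ∷_) edges-split
    ; anchors-before = λ { (here x≡u) → here x≡u ; (there x∈) → there (anchors-before x∈) }
    ; anchors-after = there ∘ anchors-after }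
    where open Split (split W v∈)

  -- The trail condition is left out, so that circuits can be cut and joined freely. It is recovered
  -- at the end: all circuits together traverse a permutation of the list of all edges, which has no
  -- repetitions.
  record Circuit : Set where
    constructor circuit
    field
      {base} : V H
      round  : Walk H base base
      long   : 2 ≤ length (edges round)

    anchorsOf = anchors round
    edgesOf   = edges round

  open Circuit

  record Merged (C D : Circuit) : Set where
    field
      merged         : Circuit
      edges-merged   : edgesOf merged ↭ edgesOf C ++ edgesOf D
      anchors-merged : ∀ {x} → x List.∈ anchorsOf merged → x List.∈ anchorsOf C ⊎ x List.∈ anchorsOf D

  -- Both circuits are rotated to start at the common anchor `v` and then run one after the other.
  merge : (C D : Circuit) {v : V H} → v List.∈ anchorsOf C → v List.∈ anchorsOf D → Merged C D
  merge C D {v} v∈C v∈D = record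
    { merged         = circuit (roundC ⊕ roundD) (≤-trans (long C) (≤-trans (m≤m+n _ _)
        (≤-reflexive (sym (trans (↭-length edges-all) (length-++ (edgesOf C)))))))
    ; edges-merged   = edges-all
    ; anchors-merged = λ x∈ → [ inj₁ ∘ backC , inj₂ ∘ backD ]′ (anchors-⊕ roundC roundD x∈)
    }
    where
    module C = Split (split (round C) v∈C)
    module D = Split (split (round D) v∈D)

    roundC roundD : Walk H v v
    roundC = C.after ⊕ C.before
    roundD = D.after ⊕ D.before

    backC : ∀ {x} → x List.∈ anchors roundC → x List.∈ anchorsOf C
    backC x∈ = [ C.anchors-after , C.anchors-before ]′ (anchors-⊕ C.after C.before x∈)

    backD : ∀ {x} → x List.∈ anchors roundD → x List.∈ anchorsOf D
    backD x∈ = [ D.anchors-after , D.anchors-before ]′ (anchors-⊕ D.after D.before x∈)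

    rotated : ∀ {u} {W : Walk H u u} (S : Split W v) →
              edges (Split.after S ⊕ Split.before S) ↭ edges W
    rotated S = ↭-trans (↭-reflexive (edges-⊕ after before))
      (↭-trans (↭-++-comm (edges after) (edges before)) (↭-reflexive edges-split))
      where open Split S

    edges-all : edges (roundC ⊕ roundD) ↭ edgesOf C ++ edgesOf D
    edges-all = ↭-trans (↭-reflexive (edges-⊕ roundC roundD))
      (++⁺ (rotated (split (round C) v∈C)) (rotated (split (round D) v∈D)))

  Apart : Circuit → Circuit → Set
  Apart C D = Disjoint (anchorsOf C) (anchorsOf D)

  Within : (V H → Set) → Circuit → Set
  Within P C = ∀ x → x List.∈ anchorsOf C → P x

  -- `anchors-within` holds for every `P` because the recursion needs it for "not an anchor of D",
  -- with D a circuit that was passed over.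
  record Inserted (C : Circuit) (G : List Circuit) : Set₁ where
    field
      circuits       : List Circuit
      apart          : AllPairs Apart circuits
      edges-inserted : concatMap edgesOf circuits ↭ edgesOf C ++ concatMap edgesOf G
      anchors-within : (P : V H → Set) → Within P C → All (Within P) G → All (Within P) circuits

  -- `C` absorbs each circuit with which it shares an anchor and carries the merged circuit on. A
  -- circuit passed over remains apart: later merging only combines anchors of `C` and of circuits
  -- that were already apart from it.
  insert : (C : Circuit) (G : List Circuit) → AllPairs Apart G → Inserted C G
  insert C [] [] = record
    { circuits = C ∷ [] ; apart = [] ∷ [] ; edges-inserted = ↭-refl ; anchors-within = λ P PC _ → PC ∷ [] }
  insert C (D ∷ G) (D∥G ∷ G∥) with Any.any? (λ v → Any.any? (v ≟_) (anchorsOf D)) (anchorsOf C)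
  ... | yes shared = record
    { circuits       = circuits
    ; apart          = apart
    ; edges-inserted = ↭-trans edges-inserted (↭-trans (++⁺ʳ (concatMap edgesOf G) edges-merged)
                         (↭-reflexive (++-assoc (edgesOf C) (edgesOf D) (concatMap edgesOf G))))
    ; anchors-within = λ { P PC (PD ∷ PG) → anchors-within P (λ x → [ PC x , PD x ]′ ∘ anchors-merged) PG }
    }
    where
    common = List.find shared
    open Merged (merge C D (proj₁ (proj₂ common)) (proj₂ (proj₂ common)))
    open Inserted (insert merged G G∥)
  ... | no ¬shared = record
    { circuits       = D ∷ circuits
    ; apart          = All.map (λ avoid {v} (v∈D , v∈) → avoid v v∈ v∈D)
                         (anchors-within (List._∉ anchorsOf D) (λ x x∈C x∈D → ¬shared (List.lose x∈C x∈D))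
                           (All.map (λ D∥E x x∈E x∈D → D∥E (x∈D , x∈E)) D∥G)) ∷ apart
    ; edges-inserted = ↭-trans (++⁺ˡ (edgesOf D) edges-inserted) (shifts (edgesOf D) (edgesOf C))
    ; anchors-within = λ { P PC (PD ∷ PG) → PD ∷ anchors-within P PC PG }
    }
    where
    open Inserted (insert C G G∥)

  separate : (G : List Circuit) → ∃ λ G′ → AllPairs Apart G′ × concatMap edgesOf G′ ↭ concatMap edgesOf G
  separate [] = [] , [] , ↭-refl
  separate (C ∷ G) with separate G
  ... | G′ , G′∥ , G′↭G = circuits , apart , ↭-trans edges-inserted (++⁺ˡ (edgesOf C) G′↭G)
    where open Inserted (insert C G′ G′∥)

  Unique-++⁻ : {A : Set} (xs : List A) {ys : List A} → Unique (xs ++ ys) → Unique xs × Unique ys × Disjoint xs ys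
  Unique-++⁻ []       u = [] , u , λ ()
  Unique-++⁻ (x ∷ xs) {ys} (x∉ ∷ u) with Unique-++⁻ xs u
  ... | uxs , uys , disj = All.tabulate (λ y∈ → All.lookup x∉ (∈-++⁺ˡ y∈)) ∷ uxs , uys , λ
    { (here refl , z∈ys) → All.lookup x∉ (∈-++⁺ʳ xs z∈ys) refl ; (there z∈xs , z∈ys) → disj (z∈xs , z∈ys) }

  trails : (G : List Circuit) → Unique (concatMap edgesOf G) → List (ClosedTrail H)
  trails []      _ = []
  trails (C ∷ G) u = record { walk = round C ; isTrail = proj₁ (Unique-++⁻ (edgesOf C) u) ; 2≤steps = long C } ∷
                     trails G (proj₁ (proj₂ (Unique-++⁻ (edgesOf C) u)))

  trails-All : {P : {v : V H} → Walk H v v → Set} (G : List Circuit) (u : Unique (concatMap edgesOf G)) →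
               All (λ C → P (round C)) G → All (λ T → P (walk T)) (trails G u)
  trails-All []      u []         = []
  trails-All {P} (C ∷ G) u (PC ∷ PG) = PC ∷ trails-All {P} G _ PG

  trails-family : (G : List Circuit) (u : Unique (concatMap edgesOf G)) → AllPairs Apart G →
                  (∀ e → e List.∈ concatMap edgesOf G) → IsEulerFamily (trails G u)
  trails-family G u G∥ all = record
    { anchorDisjoint = anchors-apart G u G∥
    ; edgeDisjoint   = edges-apart G u
    ; traversesAll   = λ e → traversed G u (all e)
    }
    where
    anchors-apart : ∀ G u → AllPairs Apart G →
                    AllPairs (λ S T → Disjoint (anchors (walk S)) (anchors (walk T))) (trails G u)
    anchors-apart []      u []          = []
    anchors-apart (C ∷ G) u (C∥G ∷ G∥) =
      trails-All {λ W → Disjoint (anchorsOf C) (anchors W)} G _ C∥G ∷ anchors-apart G _ G∥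

    edges-apart : ∀ G u → AllPairs (λ S T → Disjoint (edges (walk S)) (edges (walk T))) (trails G u)
    edges-apart []      u = []
    edges-apart (C ∷ G) u =
      trails-All {λ W → Disjoint (edgesOf C) (edges W)} G _
        (All.tabulate λ D∈G (x∈C , x∈D) → proj₂ (proj₂ (Unique-++⁻ (edgesOf C) u)) (x∈C , member D∈G x∈D)) ∷
      edges-apart G _
      where
      member : ∀ {D x G} → D List.∈ G → x List.∈ edgesOf D → x List.∈ concatMap edgesOf G
      member (here refl) x∈ = ∈-++⁺ˡ x∈
      member {G = D′ ∷ _} (there D∈) x∈ = ∈-++⁺ʳ (edgesOf D′) (member D∈ x∈)

    traversed : ∀ G u {e} → e List.∈ concatMap edgesOf G → Any (λ T → e List.∈ edges (walk T)) (trails G u)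
    traversed (C ∷ G) u e∈ with ∈-++⁻ (edgesOf C) e∈
    ... | inj₁ e∈C = here e∈C
    ... | inj₂ e∈G = there (traversed G _ e∈G)

  -- Decomposing an even choice into circuits

  module EvenChoice (p : E H → V H × V H) (within : ∀ e → proj₁ (p e) ∈ edge H e × proj₂ (p e) ∈ edge H e)
    (proper : ∀ e → Proper (p e)) where

    degree : List (E H) → V H → Bool
    degree L v = foldr (λ e s → ends (p e) v xor s) false L

    degree-↭ : ∀ {L L′} → L ↭ L′ → ∀ v → degree L v ≡ degree L′ v
    degree-↭ Perm.refl          v = refl
    degree-↭ (Perm.prep e σ)    v = cong (ends (p e) v xor_) (degree-↭ σ v)
    degree-↭ (Perm.swap {xs} {ys} e f σ)  v rewrite degree-↭ σ v =
      solve 3 (λ a b s → a :+ (b :+ s) := b :+ (a :+ s)) refl (ends (p e) v) (ends (p f) v) (degree ys v)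
      where open xor-∧-Solver
    degree-↭ (Perm.trans σ τ)   v = trans (degree-↭ σ v) (degree-↭ τ v)

    degree-true : ∀ L {v} → degree L v ≡ true → ∃ λ e → e List.∈ L × End (p e) v
    degree-true (e ∷ L) {v} eq with ends (p e) v in eq′
    ... | true  = e , here refl , proj₂ (ends-true (p e) eq′)
    ... | false = let f , f∈ , fv = degree-true L eq in f , there f∈ , fv

    pick : ∀ {e} {L : List (E H)} → e List.∈ L → ∃ λ (L′ : List (E H)) → L ↭ e ∷ L′
    pick e∈ with ∈-∃++ e∈
    ... | xs , ys , refl = xs ++ ys , shift _ xs ys

    turn : ∀ e {c} → End (p e) c → ∃ λ d → d ∈ edge H e × c ∈ edge H e × d ≢ c × (∀ v → ends (p e) v ≡ δ c v xor δ d v)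
    turn e (inj₁ refl) = _ , proj₂ (within e) , proj₁ (within e) , proper e ∘ sym , λ v → refl
    turn e (inj₂ refl) = _ , proj₁ (within e) , proj₂ (within e) , proper e , λ v → xor-comm (δ (proj₁ (p e)) v) _

    record Closed (L : List (E H)) : Set where
      field
        closed     : Circuit
        rest-edges : List (E H)
        rest-even  : ∀ v → degree rest-edges v ≡ false
        edges-used : L ↭ edgesOf closed ++ rest-edges

    -- The walk W runs from c back to a, and c, a are the vertices of odd degree in the remaining edges L.
    close : ∀ fuel {a c} (W : Walk H c a) (L : List (E H)) → length L ≤ fuel → c ≢ a → 1 ≤ length (edges W) →
            (∀ v → degree L v ≡ δ c v xor δ a v) → Closed (edges W ++ L)
    close fuel {a} {c} W L L≤ c≢a W≥1 odd = go fuel L≤ (degree-true L c-odd)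
      where
      c-odd : degree L c ≡ true
      c-odd = trans (odd c) (cong₂ _xor_ (δ-refl c) (δ-≢ (c≢a ∘ sym)))

      go : ∀ fuel → length L ≤ fuel → (∃ λ e → e List.∈ L × End (p e) c) → Closed (edges W ++ L)
      go fuel L≤ (e , e∈L , ec) with pick e∈L | turn e ec
      ... | L′ , L↭ | d , de , ce , d≢c , ends≡ = advance fuel (≤-trans (≤-reflexive (sym (↭-length L↭))) L≤) (d ≟ a)
        where
        even-after : ∀ v → degree L′ v ≡ δ d v xor δ a v
        even-after v = begin
          degree L′ v                                    ≡⟨ solve 2 (λ x s → s := x :+ (x :+ s)) refl (ends (p e) v) (degree L′ v) ⟩
          ends (p e) v xor degree (e ∷ L′) v             ≡⟨ cong₂ _xor_ (ends≡ v) (trans (sym (degree-↭ L↭ v)) (odd v)) ⟩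
          (δ c v xor δ d v) xor (δ c v xor δ a v)        ≡⟨ solve 3 (λ c d a → (c :+ d) :+ (c :+ a) := d :+ a) refl (δ c v) (δ d v) (δ a v) ⟩
          δ d v xor δ a v                                ∎
          where
          open ≡-Reasoning
          open xor-∧-Solver

        moved : edges W ++ L ↭ e ∷ edges W ++ L′
        moved = ↭-trans (++⁺ˡ (edges W) L↭) (shift e (edges W) L′)

        advance : ∀ fuel → length (e ∷ L′) ≤ fuel → Dec (d ≡ a) → Closed (edges W ++ L)
        -- `W` already has a step, so the closing step makes at least two.
        advance fuel _ (yes refl) = record
          { closed = circuit (step d e de ce d≢c W) (s≤s W≥1) ; rest-edges = L′
          ; rest-even = λ v → trans (even-after v) (xor-same (δ d v)) ; edges-used = moved }
        advance (suc fuel) (s≤s L′≤) (no d≢a) = record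
          { closed = closed ; rest-edges = rest-edges ; rest-even = rest-even ; edges-used = ↭-trans moved edges-used }
          where open Closed (close fuel (step d e de ce d≢c W) L′ L′≤ d≢a (s≤s z≤n) even-after)

    decompose : ∀ fuel (L : List (E H)) → length L ≤ fuel → (∀ v → degree L v ≡ false) →
                ∃ λ G → concatMap edgesOf G ↭ L
    decompose fuel [] _ _ = [] , ↭-refl
    decompose (suc fuel) (e ∷ L) (s≤s L≤) even = closed ∷ proj₁ others ,
      ↭-trans (++⁺ˡ (edgesOf closed) (proj₂ others)) (↭-sym edges-used)
      where
      a = proj₁ (p e)
      b = proj₂ (p e)

      odd : ∀ v → degree L v ≡ δ a v xor δ b v
      odd v = begin
        degree L v                                     ≡⟨ solve 2 (λ x s → s := x :+ (x :+ s)) refl (ends (p e) v) (degree L v) ⟩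
        ends (p e) v xor degree (e ∷ L) v              ≡⟨ cong (ends (p e) v xor_) (even v) ⟩
        ends (p e) v xor false                         ≡⟨ xor-comm (ends (p e) v) false ⟩
        δ a v xor δ b v                                ∎
        where
        open ≡-Reasoning
        open xor-∧-Solver

      open Closed (close fuel (step a e (proj₁ (within e)) (proj₂ (within e)) (proper e) (stop b)) L L≤ (proper e) (s≤s z≤n) odd)

      shorter : length rest-edges ≤ fuel
      shorter = ≤-trans (+-cancelˡ-≤ 1 _ _ (≤-trans (+-monoˡ-≤ (length rest-edges) (≤-trans (s≤s z≤n) (long closed)))
        (≤-reflexive (sym (trans (↭-length edges-used) (length-++ (edgesOf closed))))))) L≤

      others = decompose fuel rest-edges shorter rest-even

    degree-tabulate : ∀ {k} (g : Fin k → E H) v → degree (tabulate g) v ≡ ⨁ (λ i → ends (p (g i)) v)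
    degree-tabulate {zero}  g v = refl
    degree-tabulate {suc k} g v = cong (ends (p (g zero)) v xor_) (degree-tabulate (g ∘ suc) v)

    euler-family : (∀ v → ⨁ (λ e → ends (p e) v) ≡ false) → AdmitsEulerFamily H
    euler-family even =
      let G , G↭ = decompose (length (allFin (size H))) (allFin (size H)) ≤-refl (λ v → trans (degree-tabulate id v) (even v))
          G′ , G′∥ , G′↭G = separate G
          G′↭ = ↭-trans G′↭G G↭
          u = PermSetoid.Unique-resp-↭ (setoid (E H)) (↭⇒↭ₛ (↭-sym G′↭)) (allFin⁺ (size H))
      in trails G′ u , trails-family G′ u G′∥ λ e → ∈-resp-↭ (↭-sym G′↭) (∈-allFin e)

-- From covered subsets to covered pairs

count-∈ : (S : Subset n) → count (_∈? S) ≡ ∣ S ∣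
count-∈ []            = refl
count-∈ (inside  ∷ S) = cong suc (count-∈ S)
count-∈ (outside ∷ S) = count-∈ S

-- This brings two vertices into a set of the size that `covers` asks for. A position outside `S`
-- stays outside while the later positions leave enough room; otherwise ℓ is the full size.
enlarge : (S : Subset n) (ℓ : ℕ) → ∣ S ∣ ≤ ℓ → ℓ ≤ n → ∃ λ S′ → S ⊆ S′ × ∣ S′ ∣ ≡ ℓ
enlarge []            zero    _        _         = [] , id , refl
enlarge (inside ∷ S)  (suc ℓ) (s≤s S≤) (s≤s ℓ≤n) =
  let S′ , S⊆S′ , eq = enlarge S ℓ S≤ ℓ≤n in inside ∷ S′ , s⊆s S⊆S′ , cong suc eq
enlarge {suc n} (outside ∷ S) ℓ S≤ ℓ≤1+n with ℓ ≤? n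
... | yes ℓ≤n = let S′ , S⊆S′ , eq = enlarge S ℓ S≤ ℓ≤n in outside ∷ S′ , s⊆s S⊆S′ , eq
... | no ℓ≰n  = Subset⊤ , ⊆⊤ , trans (∣⊤∣≡n (suc n)) (≤-antisym (≰⇒> ℓ≰n) ℓ≤1+n)

∣⁅x⁆∪⁅y⁆∣≤2 : (x y : Fin n) → ∣ ⁅ x ⁆ ∪ ⁅ y ⁆ ∣ ≤ 2
∣⁅x⁆∪⁅y⁆∣≤2 x y = begin
  ∣ ⁅ x ⁆ ∪ ⁅ y ⁆ ∣                   ≡⟨ sym (count-∈ (⁅ x ⁆ ∪ ⁅ y ⁆)) ⟩
  count (_∈? (⁅ x ⁆ ∪ ⁅ y ⁆))         ≤⟨ sum-mono-≤ (λ v → 𝟙-union (x ≟ v) (y ≟ v) (v ∈? (⁅ x ⁆ ∪ ⁅ y ⁆)) (cases v)) ⟩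
  sum (λ v → 𝟙 (x ≟ v) + 𝟙 (y ≟ v))   ≡⟨ ∑-distrib-+ (𝟙 ∘ (x ≟_)) (𝟙 ∘ (y ≟_)) ⟩
  count (x ≟_) + count (y ≟_)         ≡⟨ cong₂ _+_ (count-≟ x) (count-≟ y) ⟩
  2                                   ∎
  where
  open ≤-Reasoning
  cases : ∀ v → v ∈ ⁅ x ⁆ ∪ ⁅ y ⁆ → x ≡ v ⊎ y ≡ v
  cases v v∈ with x∈p∪q⁻ ⁅ x ⁆ ⁅ y ⁆ v∈
  ... | inj₁ v∈x = inj₁ (sym (x∈⁅y⁆⇒x≡y x v∈x))
  ... | inj₂ v∈y = inj₂ (sym (x∈⁅y⁆⇒x≡y y v∈y))

two-elements : (L : List (Fin n)) → Unique L → 2 ≤ length L → 2 ≤ n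
two-elements {suc zero}    (zero ∷ zero ∷ _) ((0≢0 ∷ _) ∷ _) _ = contradiction refl 0≢0
two-elements {suc (suc n)} _ _ _ = s≤s (s≤s z≤n)
two-elements {suc zero}    (_ ∷ []) _ (s≤s ())

theorem1p2 : (ℓ k : ℕ) → 2 ≤ ℓ → ℓ < k → (H : Hypergraph) → Covering ℓ k H →
    AdmitsEulerFamily H ⇔ 2 ≤ size H
theorem1p2 ℓ k 2≤ℓ ℓ<k H covering = mk⇔ necessary sufficient
  where
  open Covering covering

  e₀ : E H
  e₀ = fromℕ< hasEdge

  necessary : AdmitsEulerFamily H → 2 ≤ size H
  necessary (F , family) =
    let T , _ = Any.satisfied (IsEulerFamily.traversesAll family e₀)
    in two-elements (edges (walk T)) (ClosedTrail.isTrail T) (ClosedTrail.2≤steps T)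

  ℓ≤order : ℓ ≤ order H
  ℓ≤order = ≤-trans (<⇒≤ ℓ<k) (≤-trans (≤-reflexive (sym (uniform e₀))) (∣p∣≤n (edge H e₀)))

  cover-pair : ∀ {x y} → x ≢ y → ∃ λ e → x ∈ edge H e × y ∈ edge H e
  cover-pair {x} {y} _ =
    let S , xy⊆S , ∣S∣≡ℓ = enlarge (⁅ x ⁆ ∪ ⁅ y ⁆) ℓ (≤-trans (∣⁅x⁆∪⁅y⁆∣≤2 x y) 2≤ℓ) ℓ≤order
        e , S⊆e = covers S ∣S∣≡ℓ
    in e , S⊆e (xy⊆S (p⊆p∪q ⁅ y ⁆ (x∈⁅x⁆ x))) , S⊆e (xy⊆S (q⊆p∪q ⁅ x ⁆ ⁅ y ⁆ (x∈⁅x⁆ y)))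

  sufficient : 2 ≤ size H → AdmitsEulerFamily H
  sufficient 2≤m with m≤n⇒∃[o]m+o≡n (≤-trans (s≤s 2≤ℓ) ℓ<k)
  ... | j , 3+j≡k =
    let p , within , even , proper = PairCover.perfect-choice j (λ e v → v ∈ edge H e) (λ e v → v ∈? edge H e)
          (λ e → trans (count-∈ (edge H e)) (trans (uniform e) (sym 3+j≡k))) cover-pair 2≤m
    in EvenChoice.euler-family p within proper even
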